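{- For every finite simple graph $G$ on $n$ vertices with minimum degree $\delta(G)=5$, the domination number satisfies $\gamma(G) \le \frac{n}{3}$.
   Context: A set $D \subseteq V(G)$ is a dominating set of $G$ if every vertex of $G$ is in $D$ or adjacent to a vertex of $D$. The domination number $\gamma(G)$ is the minimum cardinality of a dominating set of $G$. $\delta(G)$ denotes the minimum vertex degree of $G$. -}

module Defs where

open import Data.Nat using (ℕ; _≤_; _*_)
open import Data.Bool using (Bool; true; false)
open import Data.Fin using (Fin)
open import Data.Fin.Subset using (Subset; _∈_; ∣_∣)
open import Data.Vec using (tabulate; count)
open import Data.List using (List)
open import Data.Product using (Σ; ∃; _×_; _,_)
open import Data.Sum using (_⊎_)
open import Relation.Binary.PropositionalEquality using (_≡_)
open import Relation.Nullary using (Dec; yes; no)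

record Graph (n : ℕ) : Set where
  field
    adj      : Fin n → Fin n → Bool
    symmetric : ∀ u v → adj u v ≡ adj v u
    irreflexive : ∀ v → adj v v ≡ false

open Graph public

Adjacent : ∀ {n} → Graph n → Fin n → Fin n → Set
Adjacent G u v = adj G u v ≡ true

degree : ∀ {n} → Graph n → Fin n → ℕ
degree {n} G v = count (λ u → isTrue (adj G v u)) (tabulate (λ u → u))
  where
  isTrue : (b : Bool) → Dec (b ≡ true)
  isTrue true = yes _≡_.refl
  isTrue false = no (λ ())

MinDegree : ∀ {n} → Graph n → ℕ → Set
MinDegree {n} G d = (∀ v → d ≤ degree G v) × ∃ (λ (v : Fin n) → degree G v ≡ d)

IsDominating : ∀ {n} → Graph n → Subset n → Set
IsDominating {n} G D = ∀ (v : Fin n) → v ∈ D ⊎ ∃ (λ u → u ∈ D × Adjacent G v u)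

IsDominationNumber : ∀ {n} → Graph n → ℕ → Set
IsDominationNumber {n} G g =
  (∃ λ D → IsDominating G D × ∣ D ∣ ≡ g) × (∀ D → IsDominating G D → g ≤ ∣ D ∣)

{-# OPTIONS --safe #-}

-- Vertices are picked one by one; W is the set of white, i.e. not yet dominated, vertices, and d W x
-- is the number of white neighbours of x.  Give weight 105 to a white vertex and a weight b (d W x),
-- at most 69, to any other vertex.  The total Φ starts at 105 n and ends at 0, so it suffices that
-- on average each pick lowers it by 315.  If no pick (and no pair of picks) does so, then white
-- vertices have at most two white neighbours, other vertices at most three, and the white components
-- are isolated vertices, edges and cycles.  In that situation the white edges pay for themselves and
-- are removed; on the rest a second weight Ψ takes over, which is larger on the ends of white paths
-- and smaller on nonwhite vertices without isolated white neighbours.  When no pick lowers Ψ by 315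
-- either, take all isolated white vertices together with a dominating set of at most half of the
-- remaining white vertices (Ore): discharging shows that Ψ pays for both.  Case distinctions are
-- classical, which is harmless because the final inequality is decidable.
module Submission where

open import Defs
open import Data.Nat
open import Data.Nat.Properties
open import Data.Nat.Tactic.RingSolver using (solve-∀)
open import Data.Bool using (Bool; true; false; _∧_; _∨_; not; if_then_else_; T)
open import Data.Fin using (Fin; zero; suc) renaming (_≟_ to _≟ᶠ_)
open import Data.Fin.Subset using (∣_∣)
open import Data.Vec using (tabulate; count)
open import Data.Vec.Properties using (lookup∘tabulate; lookup⇒[]=)
open import Data.Product using (∃; _×_; _,_; proj₁; proj₂)
open import Data.Sum using (_⊎_; inj₁; inj₂)
open import Data.Empty using (⊥; ⊥-elim)
open import Function using (_∘_)
open import Relation.Nullary using (Dec; yes; no; does)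
open import Relation.Nullary.Decidable using (dec-true; dec-false; decidable-stable)
open import Relation.Binary.PropositionalEquality
import Algebra.Properties.Semiring.Sum +-*-semiring as Sum

-- The bottleneck is a nonwhite vertex z with two white neighbours, one of them isolated. Five such
-- vertices may have to finance a pick for the isolated one, so z owes it (315 - 105) / 5 = 42 out
-- of `b 2` = 51, and only 9 remain for the other neighbour. A vertex of a white cycle with three
-- such neighbours collects 105 + 3 · 9 = 132, short of the 315 / 2 that Ore's bound costs per
-- vertex. Hence z has to become profitable to pick. This is why Ψ lowers nonwhite vertices without
-- isolated white neighbours to 19 = `b 3` / 3 per white neighbour: picking z takes its isolated
-- neighbour u away from the other neighbours of u, and each of these then falls by at least 51 - 19
-- = 32, where Φ guarantees only 9. White edges must not enter Ψ, since their ends would weigh 123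
-- where Φ provides 105. They are settled while Φ is still in force, and this is the one place where
-- two picks are considered together.

private variable
  n : ℕ

-- Finite sums and indicators.

⟦_⟧ : Bool → ℕ
⟦ true ⟧ = 1
⟦ false ⟧ = 0

δ : Fin n → Fin n → ℕ
δ i k = ⟦ does (i ≟ᶠ k) ⟧

δ-refl : (i : Fin n) → δ i i ≡ 1
δ-refl i = cong ⟦_⟧ (dec-true (i ≟ᶠ i) refl)

δ-≢ : {i k : Fin n} → i ≢ k → δ i k ≡ 0
δ-≢ {i = i} {k} i≢k = cong ⟦_⟧ (dec-false (i ≟ᶠ k) i≢k)

-- Opaque so that unification can read the summand off a sum.
opaque
  ∑ : (Fin n → ℕ) → ℕ
  ∑ = Sum.sum

  ∑-cong : {f g : Fin n → ℕ} → (∀ i → f i ≡ g i) → ∑ f ≡ ∑ g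
  ∑-cong = Sum.sum-cong-≗

  ∑-+ : (f g : Fin n → ℕ) → ∑ (λ i → f i + g i) ≡ ∑ f + ∑ g
  ∑-+ = Sum.∑-distrib-+

  ∑-comm : ∀ {m n} (f : Fin m → Fin n → ℕ) → ∑ (λ i → ∑ (f i)) ≡ ∑ (λ j → ∑ (λ i → f i j))
  ∑-comm = Sum.∑-comm

  ∑-*ˡ : (c : ℕ) (f : Fin n → ℕ) → ∑ (λ i → c * f i) ≡ c * ∑ f
  ∑-*ˡ c f = sym (Sum.*-distribˡ-sum c f)

  ∑-mono : {f g : Fin n → ℕ} → (∀ i → f i ≤ g i) → ∑ f ≤ ∑ g
  ∑-mono {zero} h = z≤n
  ∑-mono {suc n} h = +-mono-≤ (h zero) (∑-mono (h ∘ suc))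

  ∑-const : ∀ n c → ∑ {n} (λ _ → c) ≡ c * n
  ∑-const zero c = sym (*-zeroʳ c)
  ∑-const (suc n) c = trans (cong (c +_) (∑-const n c)) (sym (*-suc c n))

  ∑-δ : (f : Fin n → ℕ) (i : Fin n) → ∑ (λ k → f k * δ i k) ≡ f i
  ∑-δ {suc n} f zero = trans (cong₂ _+_ (*-identityʳ (f zero))
    (trans (∑-cong (λ k → *-zeroʳ (f (suc k)))) (∑-const n 0))) (+-identityʳ _)
  ∑-δ {suc n} f (suc i) = trans (cong (_+ ∑ (λ k → f (suc k) * δ i k)) (*-zeroʳ (f zero))) (∑-δ (f ∘ suc) i)

  ∑-point : (f : Fin n → ℕ) (i : Fin n) → f i ≤ ∑ f
  ∑-point f zero = m≤m+n _ _
  ∑-point f (suc i) = ≤-trans (∑-point (f ∘ suc) i) (m≤n+m _ _)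

  ∑-positive : (f : Fin n → ℕ) → 1 ≤ ∑ f → ∃ λ i → 1 ≤ f i
  ∑-positive {suc n} f h with f zero in eq
  ... | suc m = zero , ≤-trans (s≤s z≤n) (≤-reflexive (sym eq))
  ... | zero = let i , p = ∑-positive (f ∘ suc) h in suc i , p

∑-zero : {f : Fin n → ℕ} → (∀ i → f i ≡ 0) → ∑ f ≡ 0
∑-zero {n} h = trans (∑-cong h) (∑-const n 0)

erase : Fin n → (Fin n → ℕ) → Fin n → ℕ
erase i f k = f k * ⟦ not (does (i ≟ᶠ k)) ⟧

∑-erase : (f : Fin n → ℕ) (i : Fin n) → ∑ f ≡ f i + ∑ (erase i f)
∑-erase f i = begin-equality
  ∑ f                                     ≡⟨ ∑-cong split ⟩
  ∑ (λ k → f k * δ i k + erase i f k)     ≡⟨ ∑-+ (λ k → f k * δ i k) (erase i f) ⟩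
  ∑ (λ k → f k * δ i k) + ∑ (erase i f)   ≡⟨ cong (_+ ∑ (erase i f)) (∑-δ f i) ⟩
  f i + ∑ (erase i f) ∎
  where
  open ≤-Reasoning
  split : ∀ k → f k ≡ f k * δ i k + erase i f k
  split k with does (i ≟ᶠ k)
  ... | true = sym (trans (cong₂ _+_ (*-identityʳ (f k)) (*-zeroʳ (f k))) (+-identityʳ _))
  ... | false = sym (cong₂ _+_ (*-zeroʳ (f k)) (*-identityʳ (f k)))

erase-≢ : (f : Fin n → ℕ) {i k : Fin n} → i ≢ k → erase i f k ≡ f k
erase-≢ f {i} {k} i≢k rewrite dec-false (i ≟ᶠ k) i≢k = *-identityʳ (f k)

∑-two : (f : Fin n → ℕ) {i j : Fin n} → i ≢ j → f i + f j ≤ ∑ f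
∑-two f {i} {j} i≢j = begin
  f i + f j            ≡⟨ cong (f i +_) (erase-≢ f i≢j) ⟨
  f i + erase i f j    ≤⟨ +-monoʳ-≤ (f i) (∑-point (erase i f) j) ⟩
  f i + ∑ (erase i f)  ≡⟨ ∑-erase f i ⟨
  ∑ f                  ∎
  where open ≤-Reasoning

∑-three : (f : Fin n → ℕ) {i j k : Fin n} → i ≢ j → i ≢ k → j ≢ k → f i + (f j + f k) ≤ ∑ f
∑-three f {i} {j} {k} i≢j i≢k j≢k = begin
  f i + (f j + f k)                  ≡⟨ cong₂ (λ s t → f i + (s + t)) (erase-≢ f i≢j) (erase-≢ f i≢k) ⟨
  f i + (erase i f j + erase i f k)  ≤⟨ +-monoʳ-≤ (f i) (∑-two (erase i f) j≢k) ⟩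
  f i + ∑ (erase i f)                ≡⟨ ∑-erase f i ⟨
  ∑ f                                ∎
  where open ≤-Reasoning

true≢false : ∀ {b} → b ≡ true → b ≡ false → ⊥
true≢false refl ()

-- Vertex sets as Boolean functions.

VSet : ℕ → Set
VSet n = Fin n → Bool

_∩_ _∖_ : VSet n → VSet n → VSet n
(S ∩ R) y = S y ∧ R y
(S ∖ R) y = S y ∧ not (R y)

∁ : VSet n → VSet n
∁ S y = not (S y)

size : VSet n → ℕ
size S = ∑ (λ y → ⟦ S y ⟧)

∖-intro : (S R : VSet n) {y : Fin n} → S y ≡ true → R y ≡ false → (S ∖ R) y ≡ true
∖-intro S R p q rewrite p | q = refl

∖-false : (S R : VSet n) {y : Fin n} → R y ≡ true → (S ∖ R) y ≡ false
∖-false S R {y} q rewrite q with S y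
... | true = refl
... | false = refl

∖-outside : (S R : VSet n) {y : Fin n} → S y ≡ false → (S ∖ R) y ≡ false
∖-outside S R q rewrite q = refl

∖-elim : (S R : VSet n) {y : Fin n} → (S ∖ R) y ≡ true → S y ≡ true × R y ≡ false
∖-elim S R {y} p with S y | R y
∖-elim S R {y} refl | true | false = refl , refl

∖-elim-false : (S R : VSet n) {y : Fin n} → (S ∖ R) y ≡ false → S y ≡ false ⊎ (S y ≡ true × R y ≡ true)
∖-elim-false S R {y} p with S y | R y
... | false | _ = inj₁ refl
... | true | true = inj₂ (refl , refl)
∖-elim-false S R {y} () | true | false

∩-elim : (S R : VSet n) {y : Fin n} → (S ∩ R) y ≡ true → S y ≡ true × R y ≡ true
∩-elim S R {y} p with S y | R y
... | true | true = refl , refl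

true-∩ : (S R : VSet n) {y : Fin n} → S y ≡ true → R y ≡ true → (S ∩ R) y ≡ true
true-∩ S R p q rewrite p | q = refl

num : ∀ {m n} {_ : T (m ≤ᵇ n)} → m ≤ n
num {m} {n} {t} = ≤ᵇ⇒≤ m n t

descend : ∀ {p q k} c → p + suc c ≤ q → q < suc k → p < k
descend {p} c gain h = ≤-trans (≤-trans (≤-reflexive (sym (+-comm p 1))) (+-monoʳ-≤ p (s≤s z≤n))) (≤-trans gain (s≤s⁻¹ h))

-- Adjacency, closed neighbourhoods and the accounting inequality.

module Domination {n : ℕ} (G : Graph n) (deg≥5 : ∀ x → 5 ≤ ∑ (λ y → ⟦ adj G x y ⟧)) where

  a : Fin n → Fin n → ℕ
  a x y = ⟦ adj G x y ⟧

  infix 4 _~_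
  _~_ : Fin n → Fin n → Set
  x ~ y = adj G x y ≡ true

  ~-sym : ∀ {x y} → x ~ y → y ~ x
  ~-sym {x} {y} p = trans (sym (symmetric G x y)) p

  ~⇒≢ : ∀ {x y} → x ~ y → x ≢ y
  ~⇒≢ p refl = true≢false p (irreflexive G _)

  d : VSet n → Fin n → ℕ
  d S x = ∑ (λ y → a x y * ⟦ S y ⟧)

  N[_] : Fin n → VSet n
  N[ v ] y = does (v ≟ᶠ y) ∨ adj G v y

  N-self : ∀ v → N[ v ] v ≡ true
  N-self v rewrite dec-true (v ≟ᶠ v) refl = refl

  N-adj : ∀ {v y} → v ~ y → N[ v ] y ≡ true
  N-adj {v} {y} p rewrite p with does (v ≟ᶠ y)
  ... | true = refl
  ... | false = refl

  N-elim : ∀ {v y} → N[ v ] y ≡ true → v ≡ y ⊎ v ~ y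
  N-elim {v} {y} p with v ≟ᶠ y
  ... | yes q = inj₁ q
  ... | no _ = inj₂ p

  N-false : ∀ {v y} → v ≢ y → adj G v y ≡ false → N[ v ] y ≡ false
  N-false {v} {y} v≢y q rewrite dec-false (v ≟ᶠ y) v≢y = q

  -- Discharging as a single inequality. `ch z x` is what a nonwhite z pays to a removed white
  -- neighbour x; `g` and `ξ` are the surpluses of removed and of nonwhite vertices, and `l` the
  -- losses tolerated at white vertices that stay. Adding the total of all payments to both sides
  -- turns the claim into a vertexwise one, because payments made and payments received agree after
  -- exchanging the sums over edges.
  account : (W R : VSet n) (φ φ′ l g ξ : Fin n → ℕ) (ch : Fin n → Fin n → ℕ) →
    (∀ x → W x ≡ true → R x ≡ false → φ′ x ≤ φ x + l x) →
    (∀ x → W x ≡ true → R x ≡ true → φ′ x + g x ≤ φ x + ∑ (λ z → a x z * (⟦ ∁ W z ⟧ * ch z x))) →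
    (∀ z → W z ≡ false → φ′ z + (∑ (λ y → a z y * (⟦ (W ∩ R) y ⟧ * ch z y)) + ξ z) ≤ φ z) →
    ∑ φ′ + (∑ (λ x → ⟦ (W ∩ R) x ⟧ * g x) + ∑ (λ z → ⟦ ∁ W z ⟧ * ξ z)) ≤ ∑ φ + ∑ l
  account W R φ φ′ l g ξ ch kept removed outside = +-cancelʳ-≤ (∑ (λ z → out z * B z)) _ _ (begin
    ∑ φ′ + (∑ (λ x → inn x * g x) + ∑ (λ z → out z * ξ z)) + ∑ (λ z → out z * B z)
      ≡⟨ cong (λ t → ∑ φ′ + t + ∑ (λ z → out z * B z)) (∑-+ (λ x → inn x * g x) (λ z → out z * ξ z)) ⟨
    ∑ φ′ + ∑ (λ x → inn x * g x + out x * ξ x) + ∑ (λ z → out z * B z)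
      ≡⟨ cong (_+ ∑ (λ z → out z * B z)) (∑-+ φ′ (λ x → inn x * g x + out x * ξ x)) ⟨
    ∑ (λ x → φ′ x + (inn x * g x + out x * ξ x)) + ∑ (λ z → out z * B z)
      ≡⟨ ∑-+ (λ x → φ′ x + (inn x * g x + out x * ξ x)) (λ x → out x * B x) ⟨
    ∑ (λ x → φ′ x + (inn x * g x + out x * ξ x) + out x * B x)
      ≤⟨ ∑-mono pointwise ⟩
    ∑ (λ x → φ x + l x + inn x * A x)
      ≡⟨ ∑-+ (λ x → φ x + l x) (λ x → inn x * A x) ⟩
    ∑ (λ x → φ x + l x) + ∑ (λ x → inn x * A x)
      ≡⟨ cong₂ _+_ (∑-+ φ l) swap ⟩
    ∑ φ + ∑ l + ∑ (λ z → out z * B z) ∎)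
    where
    open ≤-Reasoning
    inn out A B : Fin n → ℕ
    inn x = ⟦ (W ∩ R) x ⟧
    out z = ⟦ ∁ W z ⟧
    A x = ∑ (λ z → a x z * (out z * ch z x))
    B z = ∑ (λ y → a z y * (inn y * ch z y))

    shuffle : ∀ o k i c → i * (k * (o * c)) ≡ o * (k * (i * c))
    shuffle = solve-∀

    swap : ∑ (λ x → inn x * A x) ≡ ∑ (λ z → out z * B z)
    swap = begin-equality
      ∑ (λ x → inn x * A x)
        ≡⟨ ∑-cong (λ x → ∑-*ˡ (inn x) (λ z → a x z * (out z * ch z x))) ⟨
      ∑ (λ x → ∑ (λ z → inn x * (a x z * (out z * ch z x))))
        ≡⟨ ∑-comm (λ x z → inn x * (a x z * (out z * ch z x))) ⟩
      ∑ (λ z → ∑ (λ x → inn x * (a x z * (out z * ch z x))))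
        ≡⟨ ∑-cong (λ z → ∑-cong (λ x →
             trans (cong (λ t → inn x * (⟦ t ⟧ * (out z * ch z x))) (symmetric G x z))
                   (shuffle (out z) (a z x) (inn x) (ch z x)))) ⟩
      ∑ (λ z → ∑ (λ x → out z * (a z x * (inn x * ch z x))))
        ≡⟨ ∑-cong (λ z → ∑-*ˡ (out z) (λ x → a z x * (inn x * ch z x))) ⟩
      ∑ (λ z → out z * B z) ∎

    pointwise : ∀ x → φ′ x + (inn x * g x + out x * ξ x) + out x * B x ≤ φ x + l x + inn x * A x
    pointwise x = go (W x) (R x) refl refl
      where
      go : ∀ w r → W x ≡ w → R x ≡ r → φ′ x + (inn x * g x + out x * ξ x) + out x * B x ≤ φ x + l x + inn x * A x
      go true false p q rewrite p | q = ≤-trans (≤-reflexive (t (φ′ x))) (≤-trans (kept x p q) (≤-reflexive (sym (+-identityʳ _))))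
        where t : ∀ u → u + 0 + 0 ≡ u
              t = solve-∀
      go true true p q rewrite p | q = begin
        φ′ x + (g x + 0 + 0) + 0  ≡⟨ t (φ′ x) (g x) ⟩
        φ′ x + g x                ≤⟨ removed x p q ⟩
        φ x + A x                 ≤⟨ +-monoˡ-≤ (A x) (m≤m+n (φ x) (l x)) ⟩
        φ x + l x + A x           ≡⟨ cong (φ x + l x +_) (+-identityʳ _) ⟨
        φ x + l x + (A x + 0)     ∎
        where t : ∀ u v → u + (v + 0 + 0) + 0 ≡ u + v
              t = solve-∀
      go false r p _ rewrite p = begin
        φ′ x + (ξ x + 0) + (B x + 0)  ≡⟨ t (φ′ x) (ξ x) (B x) ⟩
        φ′ x + (B x + ξ x)            ≤⟨ outside x p ⟩
        φ x                           ≤⟨ m≤m+n (φ x) (l x) ⟩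
        φ x + l x                     ≡⟨ +-identityʳ _ ⟨
        φ x + l x + 0                 ∎
        where t : ∀ u v w → u + (v + 0) + (w + 0) ≡ u + (w + v)
              t = solve-∀

  -- Weighted and plain counts of neighbours in a set.

  D : VSet n → (Fin n → ℕ) → Fin n → ℕ
  D S f x = ∑ (λ y → a x y * (⟦ S y ⟧ * f y))

  D-const : ∀ S c x → D S (λ _ → c) x ≡ c * d S x
  D-const S c x = trans (∑-cong (λ y → t (a x y) ⟦ S y ⟧ c)) (∑-*ˡ c (λ y → a x y * ⟦ S y ⟧))
    where t : ∀ u v w → u * (v * w) ≡ w * (u * v)
          t = solve-∀

  D-mono : ∀ S {f g : Fin n → ℕ} x → (∀ y → x ~ y → S y ≡ true → f y ≤ g y) → D S f x ≤ D S g x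
  D-mono S {f} {g} x h = ∑-mono go
    where
    go : ∀ y → a x y * (⟦ S y ⟧ * f y) ≤ a x y * (⟦ S y ⟧ * g y)
    go y with adj G x y in p | S y in q
    ... | false | _ = z≤n
    ... | true | false = z≤n
    ... | true | true = +-monoˡ-≤ 0 (+-monoˡ-≤ 0 (h y p q))

  D-≤ : ∀ S {f : Fin n → ℕ} c x → (∀ y → x ~ y → S y ≡ true → f y ≤ c) → D S f x ≤ c * d S x
  D-≤ S c x h = ≤-trans (D-mono S x h) (≤-reflexive (D-const S c x))

  D-≥ : ∀ S {f : Fin n → ℕ} c x → (∀ y → x ~ y → S y ≡ true → c ≤ f y) → c * d S x ≤ D S f x
  D-≥ S c x h = ≤-trans (≤-reflexive (sym (D-const S c x))) (D-mono S x h)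

  D-point : ∀ (S : VSet n) (f : Fin n → ℕ) {x y} → x ~ y → S y ≡ true → a x y * (⟦ S y ⟧ * f y) ≡ f y
  D-point S f {x} {y} p q rewrite p | q = t (f y)
    where t : ∀ u → u + 0 + 0 ≡ u
          t = solve-∀

  D-one : ∀ (S : VSet n) (f : Fin n → ℕ) {x y} → x ~ y → S y ≡ true → f y ≤ D S f x
  D-one S f {x} {y} p q = subst (_≤ D S f x) (D-point S f p q) (∑-point (λ v → a x v * (⟦ S v ⟧ * f v)) y)

  D-two : ∀ (S : VSet n) (f : Fin n → ℕ) {x y z} → y ≢ z → x ~ y → S y ≡ true → x ~ z → S z ≡ true → f y + f z ≤ D S f x
  D-two S f {x} {y} {z} y≢z p q p′ q′ =
    subst₂ (λ s t → s + t ≤ D S f x) (D-point S f p q) (D-point S f p′ q′) (∑-two (λ v → a x v * (⟦ S v ⟧ * f v)) y≢z)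

  D-zero : ∀ (S : VSet n) (f : Fin n → ℕ) x → (∀ y → x ~ y → S y ≡ true → f y ≡ 0) → D S f x ≡ 0
  D-zero S f x h = n≤0⇒n≡0 (D-≤ S 0 x (λ y p q → ≤-reflexive (h y p q)))

  d-point : ∀ (S : VSet n) {x y} → x ~ y → S y ≡ true → a x y * ⟦ S y ⟧ ≡ 1
  d-point S p q rewrite p | q = refl

  d-one : ∀ (S : VSet n) {x y} → x ~ y → S y ≡ true → 1 ≤ d S x
  d-one S {x} {y} p q = subst (_≤ d S x) (d-point S p q) (∑-point (λ v → a x v * ⟦ S v ⟧) y)

  d-two : ∀ (S : VSet n) {x y z} → y ≢ z → x ~ y → S y ≡ true → x ~ z → S z ≡ true → 2 ≤ d S x
  d-two S {x} y≢z p q p′ q′ = subst₂ (λ s t → s + t ≤ d S x) (d-point S p q) (d-point S p′ q′) (∑-two (λ v → a x v * ⟦ S v ⟧) y≢z)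

  d-three : ∀ (S : VSet n) {x y z w} → y ≢ z → y ≢ w → z ≢ w → x ~ y → S y ≡ true → x ~ z → S z ≡ true →
            x ~ w → S w ≡ true → 3 ≤ d S x
  d-three S {x} {y} {z} {w} y≢z y≢w z≢w p q p′ q′ p″ q″ = begin
    3 ≡⟨ cong₂ _+_ (d-point S p q) (cong₂ _+_ (d-point S p′ q′) (d-point S p″ q″)) ⟨
    _ ≤⟨ ∑-three (λ v → a x v * ⟦ S v ⟧) y≢z y≢w z≢w ⟩
    d S x ∎
    where open ≤-Reasoning

  d-positive : ∀ (S : VSet n) {x} → 1 ≤ d S x → ∃ λ y → x ~ y × S y ≡ true
  d-positive S {x} h with ∑-positive (λ v → a x v * ⟦ S v ⟧) h
  ... | y , p with adj G x y in p₁ | S y in p₂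
  ... | true | true = y , p₁ , p₂

  d-zero : ∀ (S : VSet n) {x y} → d S x ≡ 0 → x ~ y → S y ≡ true → ⊥
  d-zero S eq p q = 1+n≰n (subst (1 ≤_) eq (d-one S p q))

  d-empty : ∀ S x → (∀ y → x ~ y → S y ≡ true → ⊥) → d S x ≡ 0
  d-empty S x h with d S x in eq
  ... | zero = refl
  ... | suc k = let y , p , q = d-positive S (subst (1 ≤_) (sym eq) (s≤s z≤n)) in ⊥-elim (h y p q)

  d-sub : ∀ {S S′} x → (∀ y → x ~ y → S y ≡ true → S′ y ≡ true) → d S x ≤ d S′ x
  d-sub {S} {S′} x h = ∑-mono go
    where
    go : ∀ y → a x y * ⟦ S y ⟧ ≤ a x y * ⟦ S′ y ⟧
    go y with adj G x y in p | S y in q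
    ... | false | _ = z≤n
    ... | true | false = z≤n
    ... | true | true rewrite h y p q = ≤-refl

  d-split : ∀ W R x → d W x ≡ d (W ∖ R) x + d (W ∩ R) x
  d-split W R x = trans (∑-cong go) (∑-+ (λ y → a x y * ⟦ (W ∖ R) y ⟧) (λ y → a x y * ⟦ (W ∩ R) y ⟧))
    where
    go : ∀ y → a x y * ⟦ W y ⟧ ≡ a x y * ⟦ (W ∖ R) y ⟧ + a x y * ⟦ (W ∩ R) y ⟧
    go y with adj G x y | W y | R y
    ... | false | _ | _ = refl
    ... | true | false | _ = refl
    ... | true | true | false = refl
    ... | true | true | true = refl

  d-∖ : ∀ W R x → d (W ∖ R) x ≤ d W x
  d-∖ W R x = subst (d (W ∖ R) x ≤_) (sym (d-split W R x)) (m≤m+n _ _)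

  -- The minimum degree enters the count here: few white neighbours force many nonwhite ones, and
  -- these are the vertices that pay.
  d-∁ : ∀ W x → 5 ≤ d W x + d (∁ W) x
  d-∁ W x = ≤-trans (deg≥5 x) (≤-reflexive (trans (∑-cong go) (∑-+ (λ y → a x y * ⟦ W y ⟧) (λ y → a x y * ⟦ ∁ W y ⟧))))
    where
    go : ∀ y → a x y ≡ a x y * ⟦ W y ⟧ + a x y * ⟦ ∁ W y ⟧
    go y with adj G x y | W y
    ... | false | _ = refl
    ... | true | false = refl
    ... | true | true = refl

  d-∁-≥ : ∀ W x → 5 ∸ d W x ≤ d (∁ W) x
  d-∁-≥ W x = m≤n+o⇒m∸n≤o 5 (d W x) (d-∁ W x)

  D-all : ∀ W m x → m * (5 ∸ d W x) ≤ D (∁ W) (λ _ → m) x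
  D-all W m x = ≤-trans (*-monoʳ-≤ m (d-∁-≥ W x)) (≤-reflexive (sym (D-const (∁ W) m x)))

  -- The omitted vertex v is the one to be picked. Its whole weight is booked separately, so it pays
  -- nothing to its neighbours; this turns 5 into 4.
  D-but-one : ∀ W m v x → m * (4 ∸ d W x) ≤ D (∁ W) (erase v (λ _ → m)) x
  D-but-one W m v x with 4 ∸ d W x in eq
  ... | zero = ≤-trans (≤-reflexive (*-zeroʳ m)) z≤n
  ... | suc k = +-cancelˡ-≤ m _ _ (begin
    m + m * suc k                         ≡⟨ *-suc m (suc k) ⟨
    m * (2 + k)                           ≤⟨ *-monoʳ-≤ m (≤-trans enough (d-∁-≥ W x)) ⟩
    m * d (∁ W) x                         ≡⟨ D-const (∁ W) m x ⟨
    ∑ f                                   ≡⟨ ∑-erase f v ⟩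
    f v + ∑ (erase v f)                   ≤⟨ +-mono-≤ fv≤m (≤-reflexive (∑-cong assoc)) ⟩
    m + D (∁ W) (erase v (λ _ → m)) x     ∎)
    where
    open ≤-Reasoning
    f : Fin n → ℕ
    f z = a x z * (⟦ ∁ W z ⟧ * m)
    fv≤m : f v ≤ m
    fv≤m with adj G x v | W v
    ... | false | _ = z≤n
    ... | true | false = ≤-reflexive (t m) where t : ∀ u → u + 0 + 0 ≡ u
                                                 t = solve-∀
    ... | true | true = z≤n
    assoc : ∀ z → erase v f z ≡ a x z * (⟦ ∁ W z ⟧ * erase v (λ _ → m) z)
    assoc z = t (a x z) ⟦ ∁ W z ⟧ m ⟦ not (does (v ≟ᶠ z)) ⟧
      where t : ∀ p q r s → p * (q * r) * s ≡ p * (q * (r * s))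
            t = solve-∀
    enough : 2 + k ≤ 5 ∸ d W x
    enough = lemma (d W x) k eq
      where
      lemma : ∀ e k → 4 ∸ e ≡ suc k → 2 + k ≤ 5 ∸ e
      lemma 0 k refl = ≤-refl
      lemma 1 k refl = ≤-refl
      lemma 2 k refl = ≤-refl
      lemma 3 k refl = ≤-refl
      lemma (suc (suc (suc (suc e)))) k eq with trans (sym (0∸n≡0 e)) eq
      ... | ()

  N-avoid : ∀ W v x → (∀ y → x ~ y → W y ≡ true → N[ v ] y ≡ true) → d (W ∖ N[ v ]) x ≡ 0
  N-avoid W v x h = d-empty (W ∖ N[ v ]) x
    (λ y p q → let q₁ , q₂ = ∖-elim W N[ v ] q in true≢false (h y p q₁) q₂)

  d-picked : ∀ W v → d (W ∖ N[ v ]) v ≡ 0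
  d-picked W v = N-avoid W v v (λ y p _ → N-adj p)

  -- The value b 1 is forced by a last isolated white vertex with five nonwhite neighbours, for which
  -- 105 + 5 · 42 = 315; the increments 6 and 9 below are what a vertex losing a white neighbour yields.
  b : ℕ → ℕ
  b 0 = 0
  b 1 = 42
  b 2 = 51
  b 3 = 57
  b 4 = 63
  b (suc (suc (suc (suc (suc _))))) = 69

  b-step : ∀ i → b i ≤ b (suc i)
  b-step 0 = num
  b-step 1 = num
  b-step 2 = num
  b-step 3 = num
  b-step 4 = num
  b-step (suc (suc (suc (suc (suc _))))) = ≤-refl

  b-mono : ∀ {i j} → i ≤ j → b i ≤ b j
  b-mono {i} {j} i≤j = subst (λ t → b i ≤ b t) (m∸n+n≡m i≤j) (go (j ∸ i))
    where
    go : ∀ k → b i ≤ b (k + i)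
    go zero = ≤-refl
    go (suc k) = ≤-trans (go k) (b-step (k + i))

  b≤69 : ∀ i → b i ≤ 69
  b≤69 i = ≤-trans (b-mono (m≤n+m i 5)) ≤-refl

  b-increment : ∀ m k → (∀ i → i < k → b i + m ≤ b (suc i)) → ∀ i j → i + j ≤ k → b i + m * j ≤ b (i + j)
  b-increment m k step i zero h = ≤-reflexive (trans (cong (b i +_) (*-zeroʳ m)) (trans (+-identityʳ _) (cong b (sym (+-identityʳ i)))))
  b-increment m k step i (suc j) h = begin
    b i + m * suc j     ≡⟨ t (b i) m j ⟩
    b i + m * j + m     ≤⟨ +-monoˡ-≤ m (b-increment m k step i j (<⇒≤ h′)) ⟩
    b (i + j) + m       ≤⟨ step (i + j) h′ ⟩
    b (suc (i + j))     ≡⟨ cong b (+-suc i j) ⟨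
    b (i + suc j)       ∎
    where
    open ≤-Reasoning
    h′ : i + j < k
    h′ = ≤-trans (≤-reflexive (sym (+-suc i j))) h
    t : ∀ p q r → p + q * suc r ≡ p + q * r + q
    t = solve-∀

  -- Beyond 5 the function `b` is constant, so the rate 6 becomes available only once nonwhite
  -- vertices are known to have at most five white neighbours.
  b-increment₆ : ∀ i j → i + j ≤ 5 → b i + 6 * j ≤ b (i + j)
  b-increment₆ = b-increment 6 5 step
    where
    step : ∀ i → i < 5 → b i + 6 ≤ b (suc i)
    step 0 _ = num
    step 1 _ = num
    step 2 _ = num
    step 3 _ = num
    step 4 _ = num
    step (suc (suc (suc (suc (suc i))))) (s≤s (s≤s (s≤s (s≤s (s≤s ())))))

  b-increment₉ : ∀ i j → i + j ≤ 2 → b i + 9 * j ≤ b (i + j)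
  b-increment₉ = b-increment 9 2 step
    where
    step : ∀ i → i < 2 → b i + 9 ≤ b (suc i)
    step 0 _ = num
    step 1 _ = num
    step (suc (suc i)) (s≤s (s≤s ()))

  -- The potential Φ and its change under one pick.

  weight : Bool → ℕ → ℕ
  weight true _ = 105
  weight false k = b k

  Φ : VSet n → ℕ
  Φ W = ∑ (λ x → weight (W x) (d W x))

  -- Three sources add up: the weight of v itself, which drops to 0; the gains `g` of its white
  -- neighbours, fed at rate `μ y` by their nonwhite neighbours other than v; and the leftovers `ξ`
  -- of the remaining nonwhite vertices.
  pick-nonwhite : ∀ W v → W v ≡ false → (μ ξ g : Fin n → ℕ) →
    (∀ z → W z ≡ false → z ≢ v → b (d (W ∖ N[ v ]) z) + (D (W ∩ N[ v ]) μ z + ξ z) ≤ b (d W z)) →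
    (∀ y → W y ≡ true → v ~ y → b (d (W ∖ N[ v ]) y) + g y ≤ 105 + μ y * (4 ∸ d W y)) →
    Φ (W ∖ N[ v ]) + (b (d W v) + (D W g v + ∑ (λ z → ⟦ ∁ W z ⟧ * erase v ξ z))) ≤ Φ W
  pick-nonwhite W v Wv μ ξ g outside gain = begin
    Φ W′ + (b (d W v) + (D W g v + ∑ (λ z → ⟦ ∁ W z ⟧ * erase v ξ z)))
      ≡⟨ cong (Φ W′ +_) (t (b (d W v)) (D W g v) _) ⟩
    Φ W′ + (D W g v + (b (d W v) + ∑ (λ z → ⟦ ∁ W z ⟧ * erase v ξ z)))
      ≤⟨ +-monoʳ-≤ (Φ W′) (+-mono-≤ (∑-mono D≤) (≤-reflexive own)) ⟩
    Φ W′ + (∑ (λ x → ⟦ (W ∩ N[ v ]) x ⟧ * g x) + ∑ (λ z → ⟦ ∁ W z ⟧ * ξ′ z))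
      ≤⟨ account W N[ v ] (λ x → weight (W x) (d W x)) (λ x → weight (W′ x) (d W′ x)) (λ _ → 0) g ξ′ ch kept removed outside′ ⟩
    Φ W + ∑ {n} (λ _ → 0)
      ≡⟨ cong (Φ W +_) (∑-zero (λ _ → refl)) ⟩
    Φ W + 0
      ≡⟨ +-identityʳ (Φ W) ⟩
    Φ W ∎
    where
    open ≤-Reasoning
    W′ = W ∖ N[ v ]
    ξ′ : Fin n → ℕ
    -- The weight of v is entered as a leftover at v, and `erase` exempts v from all payments.
    ξ′ z = b (d W v) * δ v z + erase v ξ z
    ch : Fin n → Fin n → ℕ
    ch z y = erase v (λ _ → μ y) z
    t : ∀ p q r → p + (q + r) ≡ q + (p + r)
    t = solve-∀
    D≤ : ∀ y → a v y * (⟦ W y ⟧ * g y) ≤ ⟦ (W ∩ N[ v ]) y ⟧ * g y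
    D≤ y with adj G v y in p | W y
    ... | false | _ = z≤n
    ... | true | false = z≤n
    ... | true | true with does (v ≟ᶠ y)
    ... | true = ≤-reflexive (+-identityʳ _)
    ... | false = ≤-reflexive (+-identityʳ _)
    own : b (d W v) + ∑ (λ z → ⟦ ∁ W z ⟧ * erase v ξ z) ≡ ∑ (λ z → ⟦ ∁ W z ⟧ * ξ′ z)
    own = begin-equality
      b (d W v) + ∑ (λ z → ⟦ ∁ W z ⟧ * erase v ξ z)
        ≡⟨ cong (λ s → s + ∑ (λ z → ⟦ ∁ W z ⟧ * erase v ξ z)) (trans (∑-δ (λ z → ⟦ ∁ W z ⟧ * b (d W v)) v) (trans (cong (λ s → ⟦ not s ⟧ * b (d W v)) Wv) (+-identityʳ _))) ⟨
      ∑ (λ z → ⟦ ∁ W z ⟧ * b (d W v) * δ v z) + ∑ (λ z → ⟦ ∁ W z ⟧ * erase v ξ z)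
        ≡⟨ ∑-+ (λ z → ⟦ ∁ W z ⟧ * b (d W v) * δ v z) (λ z → ⟦ ∁ W z ⟧ * erase v ξ z) ⟨
      ∑ (λ z → ⟦ ∁ W z ⟧ * b (d W v) * δ v z + ⟦ ∁ W z ⟧ * erase v ξ z)
        ≡⟨ ∑-cong (λ z → u ⟦ ∁ W z ⟧ (b (d W v)) (δ v z) (erase v ξ z)) ⟩
      ∑ (λ z → ⟦ ∁ W z ⟧ * ξ′ z) ∎
      where u : ∀ p q r s → p * q * r + p * s ≡ p * (q * r + s)
            u = solve-∀
    kept : ∀ x → W x ≡ true → N[ v ] x ≡ false → weight (W′ x) (d W′ x) ≤ weight (W x) (d W x) + 0
    kept x p q rewrite p | q = ≤-refl
    removed : ∀ x → W x ≡ true → N[ v ] x ≡ true →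
      weight (W′ x) (d W′ x) + g x ≤ weight (W x) (d W x) + D (∁ W) (λ z → ch z x) x
    removed x p q with N-elim q
    ... | inj₁ refl = ⊥-elim (true≢false p Wv)
    ... | inj₂ v~x rewrite p | q = ≤-trans (gain x p v~x) (+-monoʳ-≤ 105 (D-but-one W (μ x) v x))
    outside′ : ∀ z → W z ≡ false → weight (W′ z) (d W′ z) + (D (W ∩ N[ v ]) (ch z) z + ξ′ z) ≤ weight (W z) (d W z)
    outside′ z p rewrite p with z ≟ᶠ v
    ... | yes refl = begin
      b (d W′ z) + (D (W ∩ N[ z ]) (ch z) z + ξ′ z)
        ≡⟨ cong₂ (λ s r → b s + (r + ξ′ z)) (d-picked W z) (D-zero (W ∩ N[ z ]) (ch z) z (λ y _ _ → erased (μ y))) ⟩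
      b (d W z) * δ z z + erase z ξ z
        ≡⟨ cong₂ _+_ (trans (cong (b (d W z) *_) (δ-refl z)) (*-identityʳ _)) (erased (ξ z)) ⟩
      b (d W z) + 0
        ≡⟨ +-identityʳ _ ⟩
      b (d W z) ∎
      where erased : ∀ c → c * ⟦ not (does (z ≟ᶠ z)) ⟧ ≡ 0
            erased c rewrite dec-true (z ≟ᶠ z) refl = *-zeroʳ c
    ... | no z≢v = begin
      b (d W′ z) + (D (W ∩ N[ v ]) (ch z) z + ξ′ z)
        ≤⟨ +-monoʳ-≤ (b (d W′ z)) (+-mono-≤ (D-mono (W ∩ N[ v ]) z (λ y _ _ → ≤-reflexive (erase-≢ (λ _ → μ y) v≢z)))
             (≤-reflexive (cong₂ _+_ (trans (cong (b (d W v) *_) (δ-≢ v≢z)) (*-zeroʳ (b (d W v)))) (erase-≢ ξ v≢z)))) ⟩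
      b (d W′ z) + (D (W ∩ N[ v ]) μ z + ξ z)
        ≤⟨ outside z p z≢v ⟩
      b (d W z) ∎
      where v≢z = z≢v ∘ sym

  -- Here v is not among the payers, so its neighbours can count on all of their nonwhite
  -- neighbours, and v itself collects from its own.
  pick-white : ∀ W v → W v ≡ true → (m : ℕ) (g : Fin n → ℕ) →
    (∀ z → W z ≡ false → b (d (W ∖ N[ v ]) z) + m * d (W ∩ N[ v ]) z ≤ b (d W z)) →
    (∀ y → W y ≡ true → v ~ y → b (d (W ∖ N[ v ]) y) + g y ≤ 105 + m * (5 ∸ d W y)) →
    Φ (W ∖ N[ v ]) + (105 + m * (5 ∸ d W v) + D W g v) ≤ Φ W
  pick-white W v Wv m g outside gain = begin
    Φ W′ + (own + D W g v)
      ≡⟨ cong (λ s → Φ W′ + (s + D W g v)) (∑-δ (λ _ → own) v) ⟨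
    Φ W′ + (∑ (λ y → own * δ v y) + D W g v)
      ≡⟨ cong (Φ W′ +_) (∑-+ (λ y → own * δ v y) (λ y → a v y * (⟦ W y ⟧ * g y))) ⟨
    Φ W′ + ∑ (λ y → own * δ v y + a v y * (⟦ W y ⟧ * g y))
      ≤⟨ +-monoʳ-≤ (Φ W′) (∑-mono D≤) ⟩
    Φ W′ + ∑ (λ x → ⟦ (W ∩ N[ v ]) x ⟧ * g′ x)
      ≤⟨ +-monoʳ-≤ (Φ W′) (m≤m+n _ _) ⟩
    Φ W′ + (∑ (λ x → ⟦ (W ∩ N[ v ]) x ⟧ * g′ x) + ∑ (λ z → ⟦ ∁ W z ⟧ * 0))
      ≤⟨ account W N[ v ] (λ x → weight (W x) (d W x)) (λ x → weight (W′ x) (d W′ x)) (λ _ → 0) g′ (λ _ → 0) (λ _ _ → m) kept removed outside′ ⟩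
    Φ W + ∑ {n} (λ _ → 0)
      ≡⟨ cong (Φ W +_) (∑-zero (λ _ → refl)) ⟩
    Φ W + 0
      ≡⟨ +-identityʳ (Φ W) ⟩
    Φ W ∎
    where
    open ≤-Reasoning
    W′ = W ∖ N[ v ]
    own = 105 + m * (5 ∸ d W v)
    g′ : Fin n → ℕ
    g′ y = if does (v ≟ᶠ y) then own else g y
    D≤ : ∀ y → own * δ v y + a v y * (⟦ W y ⟧ * g y) ≤ ⟦ (W ∩ N[ v ]) y ⟧ * g′ y
    D≤ y with v ≟ᶠ y
    ... | yes refl rewrite Wv | irreflexive G v = ≤-reflexive (t own)
      where t : ∀ u → u * 1 + 0 ≡ u + 0
            t = solve-∀
    ... | no _ with adj G v y | W y
    ... | false | _ = ≤-trans (≤-reflexive (trans (+-identityʳ _) (*-zeroʳ own))) z≤n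
    ... | true | false = ≤-reflexive (trans (+-identityʳ _) (*-zeroʳ own))
    ... | true | true = ≤-reflexive (t own (g y))
      where t : ∀ u w → u * 0 + (w + 0 + 0) ≡ w + 0
            t = solve-∀
    kept : ∀ x → W x ≡ true → N[ v ] x ≡ false → weight (W′ x) (d W′ x) ≤ weight (W x) (d W x) + 0
    kept x p q rewrite p | q = ≤-refl
    removed : ∀ x → W x ≡ true → N[ v ] x ≡ true →
      weight (W′ x) (d W′ x) + g′ x ≤ weight (W x) (d W x) + D (∁ W) (λ _ → m) x
    removed x p q rewrite p | q with v ≟ᶠ x
    ... | yes refl rewrite d-picked W v = +-monoʳ-≤ 105 (D-all W m v)
    ... | no _ = ≤-trans (gain x p q) (+-monoʳ-≤ 105 (D-all W m x))
    outside′ : ∀ z → W z ≡ false → weight (W′ z) (d W′ z) + (D (W ∩ N[ v ]) (λ _ → m) z + 0) ≤ weight (W z) (d W z)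
    outside′ z p rewrite p =
      ≤-trans (≤-reflexive (cong (b (d W′ z) +_) (trans (+-identityʳ _) (D-const (W ∩ N[ v ]) m z)))) (outside z p)

  D-+ : ∀ S (f g : Fin n → ℕ) x → D S (λ y → f y + g y) x ≡ D S f x + D S g x
  D-+ S f g x = trans (∑-cong (λ y → t (a x y) ⟦ S y ⟧ (f y) (g y)))
    (∑-+ (λ y → a x y * (⟦ S y ⟧ * f y)) (λ y → a x y * (⟦ S y ⟧ * g y)))
    where t : ∀ p q r s → p * (q * (r + s)) ≡ p * (q * r) + p * (q * s)
          t = solve-∀

  D-bonus : ∀ S c e {x y} → x ~ y → S y ≡ true → c * d S x + e ≤ D S (λ z → c + e * δ y z) x
  D-bonus S c e {x} {y} p q = begin
    c * d S x + e                                       ≡⟨ cong₂ _+_ (D-const S c x) (trans (cong (e *_) (δ-refl y)) (*-identityʳ e)) ⟨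
    D S (λ _ → c) x + e * δ y y                         ≤⟨ +-monoʳ-≤ _ (D-one S (λ z → e * δ y z) p q) ⟩
    D S (λ _ → c) x + D S (λ z → e * δ y z) x           ≡⟨ D-+ S (λ _ → c) (λ z → e * δ y z) x ⟨
    D S (λ z → c + e * δ y z) x                         ∎
    where open ≤-Reasoning

  D-positive : ∀ (S : VSet n) (f : Fin n → ℕ) {x} → 1 ≤ D S f x → ∃ λ y → x ~ y × S y ≡ true × 1 ≤ f y
  D-positive S f {x} h with ∑-positive (λ y → a x y * (⟦ S y ⟧ * f y)) h
  ... | y , p with adj G x y in p₁ | S y in p₂
  ... | true | true = y , p₁ , p₂ , subst (1 ≤_) (t (f y)) p
    where t : ∀ u → u + 0 + 0 ≡ u
          t = solve-∀

  a-≁ : ∀ {x y} → (x ~ y → ⊥) → adj G x y ≡ false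
  a-≁ {x} {y} h with adj G x y
  ... | true = ⊥-elim (h refl)
  ... | false = refl

  -- Isolated white vertices, leaves and charges.

  isZero : ℕ → Bool
  isZero zero = true
  isZero (suc _) = false

  Iso : VSet n → VSet n
  Iso W y = W y ∧ isZero (d W y)

  Iso-elim : ∀ (W : VSet n) {u} → Iso W u ≡ true → W u ≡ true × d W u ≡ 0
  Iso-elim W {u} p with W u | d W u
  ... | true | zero = refl , refl

  Iso-intro : ∀ (W : VSet n) {u} → W u ≡ true → d W u ≡ 0 → Iso W u ≡ true
  Iso-intro W p q rewrite p | q = refl

  Iso-white-≁ : ∀ (W : VSet n) {u x} → Iso W u ≡ true → W x ≡ true → x ~ u → ⊥
  Iso-white-≁ W p q r = d-zero W (proj₂ (Iso-elim W p)) (~-sym r) q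

  isOne : ℕ → Bool
  isOne 1 = true
  isOne _ = false

  Leaves : VSet n → VSet n
  Leaves W y = W y ∧ isOne (d W y)

  Leaves-elim : ∀ (W : VSet n) {x} → Leaves W x ≡ true → W x ≡ true × d W x ≡ 1
  Leaves-elim W {x} p with W x | d W x
  ... | true | suc zero = refl , refl

  Leaves-intro : ∀ (W : VSet n) {x} → W x ≡ true → d W x ≡ 1 → Leaves W x ≡ true
  Leaves-intro W p q rewrite p | q = refl

  -- The charge a nonwhite vertex pays to each of its non-isolated white neighbours.
  share : ℕ → ℕ
  share zero = 19
  share (suc _) = 9

  σ : VSet n → Fin n → ℕ
  σ W z = share (d (Iso W) z)

  -- Configurations excluded when no pick lowers Φ enough.

  module Stage₁ (W : VSet n)
    (stuck : ∀ v → Φ (W ∖ N[ v ]) + 315 ≤ Φ W → ⊥)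
    (stuck₂ : ∀ v w → Φ ((W ∖ N[ v ]) ∖ N[ w ]) + 630 ≤ Φ W → ⊥) where

    -- The rate m is what a nonwhite vertex can afford for each white neighbour it loses, whichever
    -- set is removed.
    Marginal : ℕ → Set
    Marginal m = ∀ R z → W z ≡ false → b (d (W ∖ R) z) + m * d (W ∩ R) z ≤ b (d W z)

    marginal₀ : Marginal 0
    marginal₀ R z _ = ≤-trans (≤-reflexive (+-identityʳ _)) (b-mono (d-∖ W R z))

    marginal₆ : (∀ z → W z ≡ false → d W z ≤ 5) → Marginal 6
    marginal₆ h R z p = subst (λ k → b (d (W ∖ R) z) + 6 * d (W ∩ R) z ≤ b k) (sym (d-split W R z))
      (b-increment₆ (d (W ∖ R) z) (d (W ∩ R) z) (subst (_≤ 5) (d-split W R z) (h z p)))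

    no-white-pick : ∀ m → Marginal m → ∀ v → W v ≡ true → (g : Fin n → ℕ) →
      (∀ y → W y ≡ true → v ~ y → b (d W y ∸ 1) + g y ≤ 105 + m * (5 ∸ d W y)) →
      315 ≤ 105 + m * (5 ∸ d W v) + D W g v → ⊥
    no-white-pick m marginal v Wv g gain h = stuck v (≤-trans (+-monoʳ-≤ _ h)
      (pick-white W v Wv m g (marginal N[ v ]) (λ y p q → ≤-trans (+-monoˡ-≤ (g y) (b-mono (loses-v y q))) (gain y p q))))
      where
      loses-v : ∀ y → v ~ y → d (W ∖ N[ v ]) y ≤ d W y ∸ 1
      loses-v y q = ≤-trans (≤-reflexive (sym (m+n∸n≡m _ 1)))
        (∸-monoˡ-≤ 1 (subst (d (W ∖ N[ v ]) y + 1 ≤_) (sym (d-split W N[ v ] y))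
          (+-monoʳ-≤ _ (d-one (W ∩ N[ v ]) (~-sym q) (true-∩ W N[ v ] Wv (N-self v))))))

    no-nonwhite-pick : ∀ m → Marginal m → ∀ v → W v ≡ false → (g : Fin n → ℕ) →
      (∀ y → W y ≡ true → v ~ y → b (d W y) + g y ≤ 105 + m * (4 ∸ d W y)) →
      315 ≤ b (d W v) + D W g v → ⊥
    no-nonwhite-pick m marginal v Wv g gain h = stuck v (≤-trans (+-monoʳ-≤ _ (≤-trans h (+-monoʳ-≤ (b (d W v)) (m≤m+n _ _))))
      (pick-nonwhite W v Wv (λ _ → m) (λ _ → 0) g
        (λ z p _ → ≤-trans (≤-reflexive (cong (b (d (W ∖ N[ v ]) z) +_) (trans (+-identityʳ _) (D-const (W ∩ N[ v ]) m z)))) (marginal N[ v ] z p))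
        (λ y p q → ≤-trans (+-monoˡ-≤ (g y) (b-mono (d-∖ W N[ v ] y))) (gain y p q))))

    D-const-≥ : ∀ c {k} v → k ≤ d W v → c * k ≤ D W (λ _ → c) v
    D-const-≥ c v h = ≤-trans (*-monoʳ-≤ c h) (≤-reflexive (sym (D-const W c v)))

    -- The degree bounds feed each other. A neighbour of the picked vertex yields 105, plus what it
    -- collects, minus its new weight, so every bound on white degrees raises this yield: 36 = 105 -
    -- 69 at first, then 42 = 105 - `b 4`, then 54 and 66 once the rate 6 is available. Here 105 + 6
    -- · 36 = 321.
    white≤5 : ∀ v → W v ≡ true → d W v ≤ 5
    white≤5 v p = ≮⇒≥ λ h → no-white-pick 0 marginal₀ v p (λ _ → 36)
      (λ y _ _ → +-monoˡ-≤ 36 (b≤69 (d W y ∸ 1)))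
      (≤-trans num (+-monoʳ-≤ 105 (D-const-≥ 36 v h)))

    -- Tight, which fixes `b 4` = 63: a neighbour keeps at most four white neighbours once v is
    -- dominated, and 105 + 5 · 42 = 315.
    white≤4 : ∀ v → W v ≡ true → d W v ≤ 4
    white≤4 v p = ≮⇒≥ λ h → no-white-pick 0 marginal₀ v p (λ _ → 42)
      (λ y q _ → +-monoˡ-≤ 42 (b-mono {j = 4} (∸-monoˡ-≤ 1 (white≤5 y q))))
      (≤-trans num (+-monoʳ-≤ 105 (D-const-≥ 42 v h)))

    nonwhite≤5 : ∀ v → W v ≡ false → d W v ≤ 5
    nonwhite≤5 v p = ≮⇒≥ λ h → no-nonwhite-pick 0 marginal₀ v p (λ _ → 42)
      (λ y q _ → +-monoˡ-≤ 42 (b-mono {j = 4} (white≤4 y q)))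
      (≤-trans num (+-mono-≤ (b-mono h) (D-const-≥ 42 v h)))

    white≤3 : ∀ v → W v ≡ true → d W v ≤ 3
    white≤3 v p = ≮⇒≥ λ h → no-white-pick 6 (marginal₆ nonwhite≤5) v p (λ _ → 54)
      (λ y q _ → gain (d W y) (white≤4 y q))
      (≤-trans num (+-mono-≤ (m≤m+n 105 (6 * (5 ∸ d W v))) (D-const-≥ 54 v h)))
      where
      gain : ∀ k → k ≤ 4 → b (k ∸ 1) + 54 ≤ 105 + 6 * (5 ∸ k)
      gain 0 _ = num
      gain 1 _ = num
      gain 2 _ = num
      gain 3 _ = num
      gain 4 _ = num
      gain (suc (suc (suc (suc (suc _))))) (s≤s (s≤s (s≤s (s≤s ()))))

    -- Tight again: v brings 105 + 6 · 2, and each of its three white neighbours 66 = 105 + 6 · 2 -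
    -- `b 2`.
    white≤2 : ∀ v → W v ≡ true → d W v ≤ 2
    white≤2 v p = ≮⇒≥ λ h → no-white-pick 6 (marginal₆ nonwhite≤5) v p (λ _ → 66)
      (λ y q _ → gain (d W y) (white≤3 y q))
      (≤-trans num (+-mono-≤ (+-monoʳ-≤ 105 (*-monoʳ-≤ 6 (∸-monoʳ-≤ 5 (white≤3 v p)))) (D-const-≥ 66 v h)))
      where
      gain : ∀ k → k ≤ 3 → b (k ∸ 1) + 66 ≤ 105 + 6 * (5 ∸ k)
      gain 0 _ = num
      gain 1 _ = num
      gain 2 _ = num
      gain 3 _ = num
      gain (suc (suc (suc (suc _)))) (s≤s (s≤s (s≤s ())))

    gain₆₆ : ∀ k → k ≤ 2 → b k + 66 ≤ 105 + 6 * (4 ∸ k)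
    gain₆₆ 0 _ = num
    gain₆₆ 1 _ = num
    gain₆₆ 2 _ = num
    gain₆₆ (suc (suc (suc _))) (s≤s (s≤s ()))

    nonwhite≤3 : ∀ v → W v ≡ false → d W v ≤ 3
    nonwhite≤3 v p = ≮⇒≥ λ h → no-nonwhite-pick 6 (marginal₆ nonwhite≤5) v p (λ _ → 66)
      (λ y q _ → gain₆₆ (d W y) (white≤2 y q))
      (≤-trans num (+-mono-≤ (b-mono h) (D-const-≥ 66 v h)))

    -- If v had two white neighbours, it would bring 123 = 105 + 6 · 3, the leaf 129 = 105 + 6 · 4
    -- because it is left without white neighbours, and the other neighbour 81: altogether 333.
    leaf-neighbour : ∀ v x → W v ≡ true → W x ≡ true → v ~ x → d W x ≡ 1 → d W v ≤ 1
    leaf-neighbour v x p q v~x dx = ≮⇒≥ λ h → no-white-pick 6 (marginal₆ nonwhite≤5) v p (λ y → 81 + 48 * δ x y)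
      (λ y r _ → gain y r)
      (≤-trans num (+-mono-≤ (+-monoʳ-≤ 105 (*-monoʳ-≤ 6 (∸-monoʳ-≤ 5 (white≤2 v p))))
        (≤-trans (+-monoˡ-≤ 48 (*-monoʳ-≤ 81 h)) (D-bonus W 81 48 v~x q))))
      where
      gain₈₁ : ∀ k → k ≤ 2 → b (k ∸ 1) + 81 ≤ 105 + 6 * (5 ∸ k)
      gain₈₁ 0 _ = num
      gain₈₁ 1 _ = num
      gain₈₁ 2 _ = num
      gain₈₁ (suc (suc (suc _))) (s≤s (s≤s ()))
      gain : ∀ y → W y ≡ true → b (d W y ∸ 1) + (81 + 48 * δ x y) ≤ 105 + 6 * (5 ∸ d W y)
      gain y r with x ≟ᶠ y
      ... | yes refl rewrite dx = num
      ... | no _ = gain₈₁ (d W y) (white≤2 y r)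

    -- The isolated neighbour yields 129 = 105 + 6 · 4 instead of 66, so three white neighbours
    -- would give 57 + 129 + 2 · 66 = 318.
    near-Iso≤2 : ∀ {z u} → W z ≡ false → Iso W u ≡ true → z ~ u → d W z ≤ 2
    near-Iso≤2 {z} {u} p i z~u = ≮⇒≥ λ h → no-nonwhite-pick 6 (marginal₆ nonwhite≤5) z p (λ y → 66 + 63 * δ u y)
      (λ y r _ → gain y r)
      (≤-trans num (+-mono-≤ (b-mono h) (≤-trans (+-monoˡ-≤ 63 (*-monoʳ-≤ 66 h)) (D-bonus W 66 63 z~u (proj₁ (Iso-elim W i))))))
      where
      gain : ∀ y → W y ≡ true → b (d W y) + (66 + 63 * δ u y) ≤ 105 + 6 * (4 ∸ d W y)
      gain y r with u ≟ᶠ y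
      ... | yes refl rewrite proj₂ (Iso-elim W i) = num
      ... | no _ = gain₆₆ (d W y) (white≤2 y r)

    -- Isolated white vertices may collect at the higher rate 9: their nonwhite neighbours have at
    -- most two white neighbours, and in that range each step of `b` is at least 9.
    ν : ℕ → ℕ
    ν zero = 9
    ν (suc _) = 6

    ν≤9 : ∀ k → ν k ≤ 9
    ν≤9 zero = num
    ν≤9 (suc _) = num

    μ : Fin n → ℕ
    μ y = ν (d W y)

    μ-nonIso : ∀ {y} → W y ≡ true → (Iso W y ≡ true → ⊥) → μ y ≤ 6
    μ-nonIso {y} p h = go (d W y) refl
      where
      go : ∀ k → d W y ≡ k → ν k ≤ 6
      go zero eq = ⊥-elim (h (Iso-intro W p eq))
      go (suc _) _ = ≤-refl

    sub-increment₉ : ∀ S R z → d S z ≤ 2 → b (d (S ∖ R) z) + D (S ∩ R) μ z ≤ b (d S z)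
    sub-increment₉ S R z h = ≤-trans (+-monoʳ-≤ _ (D-≤ (S ∩ R) 9 z (λ y _ _ → ν≤9 (d W y))))
      (subst (λ k → b (d (S ∖ R) z) + 9 * d (S ∩ R) z ≤ b k) (sym (d-split S R z))
        (b-increment₉ (d (S ∖ R) z) (d (S ∩ R) z) (subst (_≤ 2) (d-split S R z) h)))

    sub-increment₆ : ∀ S R z → d S z ≤ 5 → (∀ y → z ~ y → S y ≡ true → μ y ≤ 6) →
      b (d (S ∖ R) z) + D (S ∩ R) μ z ≤ b (d S z)
    sub-increment₆ S R z h h′ = ≤-trans (+-monoʳ-≤ _ (D-≤ (S ∩ R) 6 z (λ y q r → h′ y q (proj₁ (∩-elim S R r)))))
      (subst (λ k → b (d (S ∖ R) z) + 6 * d (S ∩ R) z ≤ b k) (sym (d-split S R z))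
        (b-increment₆ (d (S ∖ R) z) (d (S ∩ R) z) (subst (_≤ 5) (d-split S R z) h)))

    -- S is kept apart from W for the sake of `one-source`, whose second pick starts from a smaller
    -- white set while rates and degree bounds are still those of W.
    sub-increment : ∀ S R z → (∀ y → S y ≡ true → W y ≡ true) → W z ≡ false →
      b (d (S ∖ R) z) + D (S ∩ R) μ z ≤ b (d S z)
    sub-increment S R z S⊆W p with d W z ≤? 2
    ... | yes h = sub-increment₉ S R z (≤-trans (d-sub z (λ y _ → S⊆W y)) h)
    ... | no h = sub-increment₆ S R z (≤-trans (d-sub z (λ y _ → S⊆W y)) (nonwhite≤5 z p))
      (λ y q r → μ-nonIso (S⊆W y r) (λ i → h (near-Iso≤2 p i q)))

    b+0≤105 : ∀ i k → b i + 0 ≤ 105 + k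
    b+0≤105 i k = ≤-trans (≤-reflexive (+-identityʳ (b i))) (≤-trans (b≤69 i) (≤-trans {j = 105} num (m≤m+n 105 k)))

    -- Each of two isolated neighbours would yield 141 = 105 + 9 · 4, and 51 + 2 · 141 = 333.
    Iso-unique : ∀ {z u u′} → W z ≡ false → Iso W u ≡ true → Iso W u′ ≡ true → z ~ u → z ~ u′ → u ≡ u′
    Iso-unique {z} {u} {u′} p i i′ z~u z~u′ with u ≟ᶠ u′
    ... | yes eq = eq
    ... | no u≢u′ = ⊥-elim (stuck z (≤-trans (+-monoʳ-≤ _ total)
            (pick-nonwhite W z p μ (λ _ → 0) g
              (λ w q _ → ≤-trans (≤-reflexive (cong (b (d (W ∖ N[ z ]) w) +_) (+-identityʳ _)))
                (sub-increment W N[ z ] w (λ _ r → r) q))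
              (λ y _ _ → gain (d (W ∖ N[ z ]) y) (d W y) (d-∖ W N[ z ] y)))))
      where
      h : ℕ → ℕ
      h zero = 141
      h (suc _) = 0
      g : Fin n → ℕ
      g y = h (d W y)
      gain : ∀ k′ k → k′ ≤ k → b k′ + h k ≤ 105 + ν k * (4 ∸ k)
      gain zero zero _ = num
      gain k′ (suc k) _ = b+0≤105 k′ (ν (suc k) * (4 ∸ suc k))
      Wu = proj₁ (Iso-elim W i)
      Wu′ = proj₁ (Iso-elim W i′)
      total : 315 ≤ b (d W z) + (D W g z + ∑ (λ w → ⟦ ∁ W w ⟧ * erase z (λ _ → 0) w))
      total = ≤-trans num (+-mono-≤ (b-mono (d-two W u≢u′ z~u Wu z~u′ Wu′)) (m≤n⇒m≤n+o _
        (subst₂ (λ s t → h s + h t ≤ D W g z) (proj₂ (Iso-elim W i)) (proj₂ (Iso-elim W i′))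
          (D-two W g u≢u′ z~u Wu z~u′ Wu′))))

    Leaf : Fin n → Set
    Leaf x = W x ≡ true × d W x ≡ 1

    Iso≢Leaf : ∀ {u x} → Iso W u ≡ true → Leaf x → u ≢ x
    Iso≢Leaf i (_ , dx) refl with trans (sym dx) (proj₂ (Iso-elim W i))
    ... | ()

    -- The yield 273 consists of 51 from v, 141 = 105 + 9 · 4 from u and 81 = 105 + 6 · 3 - `b 1`
    -- from x. It is 42 short of a pick; `few-common` and `one-source` make up the difference in two
    -- ways.
    pick-special : ∀ v u x (ξ : Fin n → ℕ) → W v ≡ false → Iso W u ≡ true → Leaf x → v ~ u → v ~ x →
      (∀ z → W z ≡ false → z ≢ v → b (d (W ∖ N[ v ]) z) + (D (W ∩ N[ v ]) μ z + ξ z) ≤ b (d W z)) →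
      Φ (W ∖ N[ v ]) + (273 + ∑ (λ z → ⟦ ∁ W z ⟧ * erase v ξ z)) ≤ Φ W
    pick-special v u x ξ p i lx@(Wx , dx) v~u v~x outside = ≤-trans
      (+-monoʳ-≤ (Φ (W ∖ N[ v ])) total)
      (pick-nonwhite W v p μ ξ g outside gain)
      where
      u≢x = Iso≢Leaf i lx
      g : Fin n → ℕ
      g y = 141 * δ u y + 81 * δ x y
      gu : g u ≡ 141
      gu rewrite δ-refl u | δ-≢ (u≢x ∘ sym) = refl
      gx : g x ≡ 81
      gx rewrite δ-refl x | δ-≢ u≢x = refl
      leaf-gain : ∀ k → k ≡ 1 → 123 ≤ 105 + ν k * (4 ∸ k)
      leaf-gain _ refl = num
      gain : ∀ y → W y ≡ true → v ~ y → b (d (W ∖ N[ v ]) y) + g y ≤ 105 + μ y * (4 ∸ d W y)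
      gain y Wy _ with u ≟ᶠ y | x ≟ᶠ y
      ... | yes refl | yes refl = ⊥-elim (u≢x refl)
      ... | yes refl | no _ rewrite n≤0⇒n≡0 (subst (d (W ∖ N[ v ]) u ≤_) (proj₂ (Iso-elim W i)) (d-∖ W N[ v ] u)) | proj₂ (Iso-elim W i) = num
      ... | no _ | yes refl = ≤-trans (+-monoˡ-≤ 81 (b-mono (subst (d (W ∖ N[ v ]) x ≤_) dx (d-∖ W N[ v ] x))))
              (leaf-gain (d W x) dx)
      ... | no _ | no _ = b+0≤105 (d (W ∖ N[ v ]) y) (μ y * (4 ∸ d W y))
      total : 273 + ∑ (λ z → ⟦ ∁ W z ⟧ * erase v ξ z) ≤ b (d W v) + (D W g v + ∑ (λ z → ⟦ ∁ W z ⟧ * erase v ξ z))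
      total = begin
        51 + 222 + X         ≡⟨ +-assoc 51 222 X ⟩
        51 + (222 + X)       ≤⟨ +-mono-≤ (b-mono (d-two W u≢x v~u Wu v~x Wx)) (+-monoˡ-≤ X (subst₂ (λ s t → s + t ≤ D W g v) gu gx (D-two W g u≢x v~u Wu v~x Wx))) ⟩
        b (d W v) + (D W g v + X) ∎
        where
        open ≤-Reasoning
        X = ∑ (λ z → ⟦ ∁ W z ⟧ * erase v ξ z)
        Wu = proj₁ (Iso-elim W i)

    common : Fin n → Fin n → Fin n → ℕ
    common u x z = a z u * a z x

    -- A further common neighbour of u and x loses both of its white neighbours, so it drops by 51
    -- and pays at most 2 · 9. Two leftovers of 33 exceed the missing 42.
    few-common : ∀ v u x → W v ≡ false → Iso W u ≡ true → Leaf x → v ~ u → v ~ x →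
      ∑ (λ z → ⟦ ∁ W z ⟧ * erase v (common u x) z) ≤ 1
    few-common v u x p i lx@(Wx , dx) v~u v~x = ≮⇒≥ λ h → stuck v (≤-trans (+-monoʳ-≤ _ (total h))
      (pick-special v u x (λ z → 33 * common u x z) p i lx v~u v~x outside))
      where
      Wu = proj₁ (Iso-elim W i)
      u≢x = Iso≢Leaf i lx
      total : 2 ≤ ∑ (λ z → ⟦ ∁ W z ⟧ * erase v (common u x) z) →
        315 ≤ 273 + ∑ (λ z → ⟦ ∁ W z ⟧ * erase v (λ z → 33 * common u x z) z)
      total h = begin
        315                       ≤⟨ num ⟩
        273 + 33 * 2              ≤⟨ +-monoʳ-≤ 273 (*-monoʳ-≤ 33 h) ⟩
        273 + 33 * ∑ (λ z → ⟦ ∁ W z ⟧ * erase v (common u x) z)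
          ≡⟨ cong (273 +_) (∑-*ˡ 33 _) ⟨
        273 + ∑ (λ z → 33 * (⟦ ∁ W z ⟧ * erase v (common u x) z))
          ≡⟨ cong (273 +_) (∑-cong (λ z → t ⟦ ∁ W z ⟧ (common u x z) ⟦ not (does (v ≟ᶠ z)) ⟧)) ⟩
        273 + ∑ (λ z → ⟦ ∁ W z ⟧ * erase v (λ z → 33 * common u x z) z) ∎
        where
        open ≤-Reasoning
        t : ∀ p q r → 33 * (p * (q * r)) ≡ p * (33 * q * r)
        t = solve-∀
      both-lost : ∀ k′ l k → k ≡ k′ + l → k ≤ 2 → 2 ≤ l → b k′ + (9 * l + 33) ≤ b k
      both-lost zero l@(suc (suc zero)) k refl h h′ = num
      both-lost zero (suc (suc (suc l))) k refl (s≤s (s≤s ())) h′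
      both-lost zero (suc zero) k refl h (s≤s ())
      both-lost (suc k′) l k refl (s≤s h) h′ = ⊥-elim (1+n≰n (≤-trans h′ (≤-trans (m≤n+m l k′) h)))
      outside : ∀ z → W z ≡ false → z ≢ v →
        b (d (W ∖ N[ v ]) z) + (D (W ∩ N[ v ]) μ z + 33 * common u x z) ≤ b (d W z)
      outside z q _ with adj G z u in z~u | adj G z x in z~x
      ... | true | true = ≤-trans
        (+-monoʳ-≤ (b (d (W ∖ N[ v ]) z)) (+-monoˡ-≤ 33 (D-≤ (W ∩ N[ v ]) 9 z (λ y _ _ → ν≤9 (d W y)))))
        (both-lost (d (W ∖ N[ v ]) z) (d (W ∩ N[ v ]) z) (d W z) (d-split W N[ v ] z) (near-Iso≤2 q i z~u)
          (d-two (W ∩ N[ v ]) u≢x z~u (true-∩ W N[ v ] Wu (N-adj v~u)) z~x (true-∩ W N[ v ] Wx (N-adj v~x))))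
      ... | true | false = ≤-trans (≤-reflexive (cong (b (d (W ∖ N[ v ]) z) +_) (+-identityʳ _)))
                (sub-increment W N[ v ] z (λ _ r → r) q)
      ... | false | _ = ≤-trans (≤-reflexive (cong (b (d (W ∖ N[ v ]) z) +_) (+-identityʳ _)))
                (sub-increment W N[ v ] z (λ _ r → r) q)

    -- The first pick yields 273 and leaves y isolated, so the second yields 51 + 141 + 129 + 36 =
    -- 357, together 2 · 315. The 36 come from x, which has become nonwhite with y as its only white
    -- neighbour.
    one-source : ∀ {v₁ u₁ x v₂ u₂ y} → W v₁ ≡ false → Iso W u₁ ≡ true → Leaf x → v₁ ~ u₁ → v₁ ~ x →
      W v₂ ≡ false → Iso W u₂ ≡ true → Leaf y → v₂ ~ u₂ → v₂ ~ y → x ~ y → u₁ ≢ u₂ → ⊥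
    one-source {v₁} {u₁} {x} {v₂} {u₂} {y} p₁ i₁ lx@(Wx , dx) v₁~u₁ v₁~x p₂ i₂ ly@(Wy , dy) v₂~u₂ v₂~y x~y u₁≢u₂ =
      stuck₂ v₁ v₂ (begin
        Φ W₂ + 630           ≡⟨ +-assoc (Φ W₂) 357 273 ⟨
        Φ W₂ + 357 + 273     ≤⟨ +-monoˡ-≤ 273 second ⟩
        Φ W₁ + 273           ≤⟨ first ⟩
        Φ W                  ∎)
      where
      open ≤-Reasoning
      W₁ W₂ : VSet n
      W₁ = W ∖ N[ v₁ ]
      W₂ = W₁ ∖ N[ v₂ ]
      Wu₁ = proj₁ (Iso-elim W i₁)
      Wu₂ = proj₁ (Iso-elim W i₂)
      du₂ = proj₂ (Iso-elim W i₂)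
      W₁⊆W : ∀ y → W₁ y ≡ true → W y ≡ true
      W₁⊆W y q = proj₁ (∖-elim W N[ v₁ ] q)
      white≢ : ∀ {s t} → W s ≡ false → W t ≡ true → s ≢ t
      white≢ p q refl = true≢false q p

      first : Φ W₁ + 273 ≤ Φ W
      first = ≤-trans (+-monoʳ-≤ (Φ W₁) (m≤m+n 273 _)) (pick-special v₁ u₁ x (λ _ → 0) p₁ i₁ lx v₁~u₁ v₁~x
        (λ z q _ → ≤-trans (≤-reflexive (cong (b (d W₁ z) +_) (+-identityʳ _))) (sub-increment W N[ v₁ ] z (λ _ r → r) q)))

      W₁u₂ : W₁ u₂ ≡ true
      W₁u₂ = ∖-intro W N[ v₁ ] Wu₂ (N-false (white≢ p₁ Wu₂) (a-≁ (λ q → u₁≢u₂ (Iso-unique p₁ i₁ i₂ v₁~u₁ q))))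
      W₁y : W₁ y ≡ true
      -- Otherwise `v₁` would have three white neighbours, one of them isolated.
      W₁y = ∖-intro W N[ v₁ ] Wy (N-false (white≢ p₁ Wy) (a-≁ (λ q → 1+n≰n (≤-trans
        (d-three W (Iso≢Leaf i₁ lx) (Iso≢Leaf i₁ ly) (~⇒≢ x~y) v₁~u₁ Wu₁ v₁~x Wx q Wy) (near-Iso≤2 p₁ i₁ v₁~u₁)))))
      W₁x : W₁ x ≡ false
      W₁x = ∖-false W N[ v₁ ] (N-adj v₁~x)
      d₁y : d W₁ y ≡ 0
      d₁y = d-empty W₁ y only-x
        where
        only-x : ∀ t → y ~ t → W₁ t ≡ true → ⊥
        only-x t q r with t ≟ᶠ x
        ... | yes refl = true≢false r W₁x
        ... | no t≢x = 1+n≰n (subst (2 ≤_) dy (d-two W t≢x q (W₁⊆W t r) (~-sym x~y) Wx))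

      u₂≢y = Iso≢Leaf i₂ ly
      g ξ : Fin n → ℕ
      g t = 141 * δ u₂ t + 129 * δ y t
      ξ z = 36 * δ x z
      gu₂ : g u₂ ≡ 141
      gu₂ rewrite δ-refl u₂ | δ-≢ (u₂≢y ∘ sym) = refl
      gy : g y ≡ 129
      gy rewrite δ-refl y | δ-≢ u₂≢y = refl

      gain : ∀ t → W₁ t ≡ true → v₂ ~ t → b (d W₂ t) + g t ≤ 105 + μ t * (4 ∸ d W₁ t)
      gain t q _ with u₂ ≟ᶠ t | y ≟ᶠ t
      ... | yes refl | yes refl = ⊥-elim (u₂≢y refl)
      ... | yes refl | no _ rewrite n≤0⇒n≡0 (subst (d W₁ u₂ ≤_) du₂ (d-∖ W N[ v₁ ] u₂))
                                  | n≤0⇒n≡0 (subst (d W₂ u₂ ≤_) du₂ (≤-trans (d-∖ W₁ N[ v₂ ] u₂) (d-∖ W N[ v₁ ] u₂)))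
                                  | du₂ = num
      ... | no _ | yes refl rewrite n≤0⇒n≡0 (subst (d W₂ y ≤_) d₁y (d-∖ W₁ N[ v₂ ] y)) | d₁y | dy = num
      ... | no _ | no _ = b+0≤105 (d W₂ t) (μ t * (4 ∸ d W₁ t))

      -- x falls from `b 1` = 42 to 0 and pays y at rate 6, which leaves 36.
      widow : ∀ k′ l k D → k ≡ k′ + l → k ≤ 1 → 1 ≤ l → D ≤ 6 * l → b k′ + (D + 36) ≤ b k
      widow zero (suc zero) k D refl h h′ e = +-monoˡ-≤ 36 e
      widow zero (suc (suc l)) k D refl (s≤s ()) h′ e
      widow (suc k′) l k D refl (s≤s h) h′ e = ⊥-elim (1+n≰n (≤-trans h′ (≤-trans (m≤n+m l k′) h)))

      outside : ∀ z → W₁ z ≡ false → z ≢ v₂ → b (d W₂ z) + (D (W₁ ∩ N[ v₂ ]) μ z + ξ z) ≤ b (d W₁ z)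
      outside z q _ with x ≟ᶠ z
      ... | yes refl = widow (d W₂ x) (d (W₁ ∩ N[ v₂ ]) x) (d W₁ x) (D (W₁ ∩ N[ v₂ ]) μ x) (d-split W₁ N[ v₂ ] x)
              (subst (d W₁ x ≤_) dx (d-∖ W N[ v₁ ] x))
              (d-one (W₁ ∩ N[ v₂ ]) x~y (true-∩ W₁ N[ v₂ ] W₁y (N-adj v₂~y)))
              (D-≤ (W₁ ∩ N[ v₂ ]) 6 x (λ t x~t r → μ-nonIso (W₁⊆W t (proj₁ (∩-elim W₁ N[ v₂ ] r))) (λ i → Iso-white-≁ W i Wx x~t)))
      ... | no x≢z = ≤-trans (≤-reflexive (cong (b (d W₂ z) +_) (+-identityʳ _))) rest
        where
        rest : b (d W₂ z) + D (W₁ ∩ N[ v₂ ]) μ z ≤ b (d W₁ z)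
        rest with ∖-elim-false W N[ v₁ ] q
        ... | inj₁ Wz = sub-increment W₁ N[ v₂ ] z W₁⊆W Wz
        ... | inj₂ (Wz , _) = sub-increment₆ W₁ N[ v₂ ] z (≤-trans (d-∖ W N[ v₁ ] z) (≤-trans (white≤2 z Wz) num))
                (λ t z~t r → μ-nonIso (W₁⊆W t r) (λ i → Iso-white-≁ W i Wz z~t))

      second : Φ W₂ + 357 ≤ Φ W₁
      second = ≤-trans (+-monoʳ-≤ (Φ W₂) total)
        (pick-nonwhite W₁ v₂ (∖-outside W N[ v₁ ] p₂) μ ξ g outside gain)
        where
        at-x : ⟦ ∁ W₁ x ⟧ * erase v₂ ξ x ≡ 36
        at-x rewrite W₁x | erase-≢ ξ (white≢ p₂ Wx) | δ-refl x = refl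
        total : 357 ≤ b (d W₁ v₂) + (D W₁ g v₂ + ∑ (λ z → ⟦ ∁ W₁ z ⟧ * erase v₂ ξ z))
        total = +-mono-≤ {51} (b-mono (d-two W₁ u₂≢y v₂~u₂ W₁u₂ v₂~y W₁y))
          (+-mono-≤ {270} (subst₂ (λ s t → s + t ≤ D W₁ g v₂) gu₂ gy (D-two W₁ g u₂≢y v₂~u₂ W₁u₂ v₂~y W₁y))
            (subst (_≤ ∑ (λ z → ⟦ ∁ W₁ z ⟧ * erase v₂ ξ z)) at-x (∑-point _ x)))

    -- Charges reaching the two ends of a white edge.

    sign : ℕ → ℕ
    sign zero = 0
    sign (suc _) = 1

    near-Iso : Fin n → ℕ
    near-Iso z = sign (d (Iso W) z)

    find-Iso : ∀ {z} → 1 ≤ near-Iso z → ∃ λ u → z ~ u × Iso W u ≡ true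
    find-Iso {z} h = d-positive (Iso W) (lemma (d (Iso W) z) h)
      where
      lemma : ∀ k → 1 ≤ sign k → 1 ≤ k
      lemma (suc k) _ = s≤s z≤n

    S s : Fin n → ℕ
    S x = D (∁ W) (σ W) x
    s x = D (∁ W) near-Iso x

    -- By `one-source`, the nonwhite neighbours of x that see an isolated vertex all see the same
    -- one, that of `v₂`. Three of them would be common neighbours of x and this vertex, one more
    -- than `few-common` allows.
    few-near-Iso : ∀ x y → Leaf x → Leaf y → x ~ y → 3 ≤ s x → 1 ≤ s y → ⊥
    few-near-Iso x y lx ly x~y sx sy
      with D-positive (∁ W) near-Iso {y} sy | D-positive (∁ W) near-Iso {x} (≤-trans num sx)
    ... | v₂ , y~v₂ , p₂ , e₂ | v₁ , x~v₁ , p₁ , e₁ with find-Iso e₂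
    ... | u , v₂~u , i = 1+n≰n (≤-trans (+-cancelˡ-≤ 1 _ _ enough) (few-common v₁ u x (nonwhite p₁) i lx (near v₁ x~v₁ p₁ e₁) (~-sym x~v₁)))
      where
      open ≤-Reasoning
      nonwhite : ∀ {z} → ∁ W z ≡ true → W z ≡ false
      nonwhite {z} p with W z
      ... | false = refl
      near : ∀ z → x ~ z → ∁ W z ≡ true → 1 ≤ near-Iso z → z ~ u
      near z x~z p e with adj G z u in eq
      ... | true = refl
      ... | false = let u′ , z~u′ , i′ = find-Iso e in
        ⊥-elim (one-source (nonwhite p) i′ lx z~u′ (~-sym x~z) (nonwhite p₂) i ly v₂~u (~-sym y~v₂) x~y
          (λ { refl → true≢false z~u′ eq }))
      sign≤1 : ∀ k → sign k ≤ 1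
      sign≤1 zero = z≤n
      sign≤1 (suc _) = ≤-refl
      f : Fin n → ℕ
      f z = ⟦ ∁ W z ⟧ * common u x z
      covered : ∀ z → a x z * (⟦ ∁ W z ⟧ * near-Iso z) ≤ f z
      covered z = go (adj G x z) (∁ W z) (near-Iso z) refl refl refl
        where
        go : ∀ α β k → adj G x z ≡ α → ∁ W z ≡ β → near-Iso z ≡ k → ⟦ α ⟧ * (⟦ β ⟧ * k) ≤ ⟦ β ⟧ * common u x z
        go false _ _ _ _ _ = z≤n
        go true false _ _ _ _ = z≤n
        go true true zero _ _ _ = z≤n
        go true true (suc k) α β eq rewrite near z α β (subst (1 ≤_) (sym eq) (s≤s z≤n)) | ~-sym α =
          ≤-trans (≤-reflexive (t (suc k))) (subst (_≤ 1) eq (sign≤1 (d (Iso W) z)))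
          where t : ∀ p → p + 0 + 0 ≡ p
                t = solve-∀
      at-v₁ : f v₁ ≤ 1
      at-v₁ with ∁ W v₁ | adj G v₁ u | adj G v₁ x
      ... | false | _ | _ = z≤n
      ... | true | false | _ = z≤n
      ... | true | true | false = z≤n
      ... | true | true | true = ≤-refl
      enough : 1 + 2 ≤ 1 + ∑ (λ z → ⟦ ∁ W z ⟧ * erase v₁ (common u x) z)
      enough = begin
        3                       ≤⟨ sx ⟩
        s x                     ≤⟨ ∑-mono covered ⟩
        ∑ f                     ≡⟨ ∑-erase f v₁ ⟩
        f v₁ + ∑ (erase v₁ f)   ≤⟨ +-monoˡ-≤ _ at-v₁ ⟩
        1 + ∑ (erase v₁ f)      ≡⟨ cong suc (∑-cong (λ z → *-assoc ⟦ ∁ W z ⟧ (common u x z) _)) ⟩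
        1 + ∑ (λ z → ⟦ ∁ W z ⟧ * erase v₁ (common u x) z) ∎

    S+10s : ∀ x → S x + 10 * s x ≡ 19 * d (∁ W) x
    S+10s x = begin
      S x + 10 * s x                                        ≡⟨ cong (S x +_) (trans (∑-cong (λ z → t (a x z) ⟦ ∁ W z ⟧ (near-Iso z))) (∑-*ˡ 10 _)) ⟨
      S x + D (∁ W) (λ z → 10 * near-Iso z) x               ≡⟨ D-+ (∁ W) (σ W) (λ z → 10 * near-Iso z) x ⟨
      D (∁ W) (λ z → σ W z + 10 * near-Iso z) x             ≡⟨ ∑-cong (λ z → cong (λ k → a x z * (⟦ ∁ W z ⟧ * k)) (nineteen (d (Iso W) z))) ⟩
      D (∁ W) (λ _ → 19) x                                  ≡⟨ D-const (∁ W) 19 x ⟩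
      19 * d (∁ W) x                                        ∎
      where
      open ≡-Reasoning
      t : ∀ p q r → p * (q * (10 * r)) ≡ 10 * (p * (q * r))
      t = solve-∀
      nineteen : ∀ k → share k + 10 * sign k ≡ 19
      nineteen zero = refl
      nineteen (suc _) = refl

    -- The target 105 is 315 - 2 · 105. Each end has at least four nonwhite neighbours, so full
    -- charges would give 8 · 19 = 152, and each neighbour near an isolated vertex costs 10. With at
    -- most two of these at either end 112 remain; if one end has three, the other has none and 36 +
    -- 76 = 112 again.
    leaf-pair : ∀ x y → Leaf x → Leaf y → x ~ y → 105 ≤ S x + S y
    leaf-pair x y lx ly x~y = ≮⇒≥ λ h → poor (s≤s⁻¹ h)
      where
      open ≤-Reasoning
      four : ∀ {z} → Leaf z → 4 ≤ d (∁ W) z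
      four {z} (_ , dz) = subst (λ k → 5 ∸ k ≤ d (∁ W) z) dz (d-∁-≥ W z)
      nine : ∀ {z} → Leaf z → 36 ≤ S z
      nine {z} lz = ≤-trans (*-monoʳ-≤ 9 (four lz)) (D-≥ (∁ W) 9 z (λ w _ _ → 9≤share (d (Iso W) w)))
        where
        9≤share : ∀ k → 9 ≤ share k
        9≤share zero = num
        9≤share (suc _) = ≤-refl
      some : ∀ {z w} → Leaf z → Leaf w → S z + S w ≤ 104 → 1 ≤ s z
      some {z} {w} lz lw h with s z in eq
      ... | suc _ = s≤s z≤n
      ... | zero = ⊥-elim (<⇒≱ {104} {112} num (begin
        112                                  ≤⟨ +-mono-≤ (*-monoʳ-≤ 19 (four lz)) (nine lw) ⟩
        19 * d (∁ W) z + S w                 ≡⟨ cong (_+ S w) (S+10s z) ⟨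
        S z + 10 * s z + S w                 ≡⟨ cong (λ k → S z + 10 * k + S w) eq ⟩
        S z + 0 + S w                        ≡⟨ cong (_+ S w) (+-identityʳ (S z)) ⟩
        S z + S w                            ≤⟨ h ⟩
        104                                  ∎))
      poor : S x + S y ≤ 104 → ⊥
      poor h with 3 ≤? s x | 3 ≤? s y
      ... | yes p | _ = few-near-Iso x y lx ly x~y p (some ly lx (subst (_≤ 104) (+-comm (S x) (S y)) h))
      ... | no _ | yes q = few-near-Iso y x ly lx (~-sym x~y) q (some lx ly h)
      ... | no p | no q = <⇒≱ {144} {152} num (begin
        152                                        ≤⟨ +-mono-≤ (*-monoʳ-≤ 19 (four lx)) (*-monoʳ-≤ 19 (four ly)) ⟩
        19 * d (∁ W) x + 19 * d (∁ W) y            ≡⟨ cong₂ _+_ (S+10s x) (S+10s y) ⟨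
        S x + 10 * s x + (S y + 10 * s y)          ≡⟨ t (S x) (S y) (s x) (s y) ⟩
        S x + S y + 10 * (s x + s y)               ≤⟨ +-mono-≤ h (*-monoʳ-≤ 10 (+-mono-≤ (s≤s⁻¹ (≰⇒> p)) (s≤s⁻¹ (≰⇒> q)))) ⟩
        144                                        ∎)
        where t : ∀ p q k l → p + 10 * k + (q + 10 * l) ≡ p + q + 10 * (k + l)
              t = solve-∀

  -- Partial dominating sets and Ore's bound.

  Dominates : VSet n → VSet n → Set
  Dominates A W = ∀ x → W x ≡ true → ∃ λ y → A y ≡ true × (x ≡ y ⊎ x ~ y)

  Coverable : VSet n → ℕ → Set
  Coverable W k = ∃ λ A → Dominates A W × 315 * size A ≤ k

  _∪_ : VSet n → VSet n → VSet n
  (A ∪ B) y = A y ∨ B y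

  ∪-left : ∀ (A B : VSet n) {y} → A y ≡ true → (A ∪ B) y ≡ true
  ∪-left A B p rewrite p = refl

  ∪-right : ∀ (A B : VSet n) {y} → B y ≡ true → (A ∪ B) y ≡ true
  ∪-right A B {y} p rewrite p with A y
  ... | true = refl
  ... | false = refl

  size-∪ : ∀ (A B : VSet n) → size (A ∪ B) ≤ size A + size B
  size-∪ A B = ≤-trans (∑-mono go) (≤-reflexive (∑-+ (λ y → ⟦ A y ⟧) (λ y → ⟦ B y ⟧)))
    where
    go : ∀ y → ⟦ A y ∨ B y ⟧ ≤ ⟦ A y ⟧ + ⟦ B y ⟧
    go y with A y | B y
    ... | true | true = num
    ... | true | false = num
    ... | false | _ = ≤-refl

  ⁅_⁆ : Fin n → VSet n
  ⁅ v ⁆ y = does (v ≟ᶠ y)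

  size-⁅⁆ : ∀ v → size ⁅ v ⁆ ≡ 1
  size-⁅⁆ v = trans (∑-cong (λ y → sym (*-identityˡ (δ v y)))) (∑-δ (λ _ → 1) v)

  size-split : ∀ (S R : VSet n) → size S ≡ size (S ∩ R) + size (S ∖ R)
  size-split S R = trans (∑-cong go) (∑-+ (λ y → ⟦ (S ∩ R) y ⟧) (λ y → ⟦ (S ∖ R) y ⟧))
    where
    go : ∀ y → ⟦ S y ⟧ ≡ ⟦ (S ∩ R) y ⟧ + ⟦ (S ∖ R) y ⟧
    go y with S y | R y
    ... | false | _ = refl
    ... | true | false = refl
    ... | true | true = refl

  Dominates-∪ : ∀ (A B W R : VSet n) → Dominates A (W ∖ R) → (∀ x → W x ≡ true → R x ≡ true → ∃ λ y → B y ≡ true × (x ≡ y ⊎ x ~ y)) →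
    Dominates (A ∪ B) W
  Dominates-∪ A B W R h h′ x p with R x in eq
  ... | false = let y , q , r = h x (∖-intro W R p eq) in y , ∪-left A B q , r
  ... | true = let y , q , r = h′ x p eq in y , ∪-right A B q , r

  Coverable-≤ : ∀ W {k k′} → k ≤ k′ → Coverable W k → Coverable W k′
  Coverable-≤ W h (A , p , q) = A , p , ≤-trans q h

  pick : ∀ W v {k} → Coverable (W ∖ N[ v ]) k → Coverable W (k + 315)
  pick W v {k} (A , p , q) = A ∪ ⁅ v ⁆ , Dominates-∪ A ⁅ v ⁆ W N[ v ] p near , (begin
    315 * size (A ∪ ⁅ v ⁆)          ≤⟨ *-monoʳ-≤ 315 (size-∪ A ⁅ v ⁆) ⟩
    315 * (size A + size ⁅ v ⁆)     ≡⟨ cong (λ s → 315 * (size A + s)) (size-⁅⁆ v) ⟩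
    315 * (size A + 1)              ≡⟨ *-distribˡ-+ 315 (size A) 1 ⟩
    315 * size A + 315              ≤⟨ +-monoˡ-≤ 315 q ⟩
    k + 315                         ∎)
    where
    open ≤-Reasoning
    near : ∀ x → W x ≡ true → N[ v ] x ≡ true → ∃ λ y → ⁅ v ⁆ y ≡ true × (x ≡ y ⊎ x ~ y)
    near x _ r with N-elim r
    ... | inj₁ v≡x = v , dec-true (v ≟ᶠ v) refl , inj₁ (sym v≡x)
    ... | inj₂ v~x = v , dec-true (v ≟ᶠ v) refl , inj₂ (~-sym v~x)

  -- Ore's bound: if O is a minimal dominating set, then its complement also dominates.
  half : ∀ S → (∀ x → S x ≡ true → 1 ≤ d S x) → ((∃ λ O → Dominates O S × 2 * size O ≤ size S) → ⊥) → ⊥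
  half S no-isolated bad = shrink (size S) S (λ _ p → p) (λ x p → x , p , inj₁ refl) ≤-refl
    where
    shrink : ∀ k O → (∀ x → O x ≡ true → S x ≡ true) → Dominates O S → size O ≤ k → ⊥
    shrink k O O⊆S dom size≤ with 2 * size O ≤? size S
    ... | yes small = bad (O , dom , small)
    ... | no large = bad (S ∖ O , complement , <⇒≤ small)
      where
      open ≤-Reasoning
      size-O : size (S ∩ O) ≡ size O
      size-O = ∑-cong go
        where
        go : ∀ y → ⟦ (S ∩ O) y ⟧ ≡ ⟦ O y ⟧
        go y with O y in eq
        ... | true rewrite O⊆S y eq = refl
        ... | false with S y
        ... | true = refl
        ... | false = refl
      total : size O + size (S ∖ O) ≡ size S
      total = sym (trans (size-split S O) (cong (_+ size (S ∖ O)) size-O))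
      small : 2 * size (S ∖ O) < size S
      small = +-cancelˡ-< (2 * size O) (2 * size (S ∖ O)) (size S) (begin-strict
        2 * size O + 2 * size (S ∖ O)  ≡⟨ *-distribˡ-+ 2 (size O) (size (S ∖ O)) ⟨
        2 * (size O + size (S ∖ O))    ≡⟨ cong (2 *_) total ⟩
        2 * size S                     ≡⟨ t (size S) ⟩
        size S + size S                <⟨ +-monoˡ-< (size S) (≰⇒> large) ⟩
        2 * size O + size S            ∎)
        where t : ∀ u → 2 * u ≡ u + u
              t = solve-∀
      -- If x has no neighbour in the complement, all its neighbours in S lie in O, and there is at
      -- least one; so O still dominates without x.
      redundant : ∀ x → O x ≡ true → d (S ∖ O) x ≡ 0 → ⊥
      redundant x Ox none = removal k size≤
        where
        O′ : VSet n
        O′ = O ∖ ⁅ x ⁆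
        inside : ∀ {w} → S w ≡ true → x ~ w → O w ≡ true
        inside {w} Sw x~w with O w in eq
        ... | true = refl
        ... | false = ⊥-elim (d-zero (S ∖ O) none x~w (∖-intro S O Sw eq))
        keep : ∀ {w} → O w ≡ true → x ≢ w → O′ w ≡ true
        keep {w} Ow x≢w = ∖-intro O ⁅ x ⁆ Ow (dec-false (x ≟ᶠ w) x≢w)
        dom′ : Dominates O′ S
        dom′ w Sw with dom w Sw
        ... | y , Oy , near with x ≟ᶠ y
        ... | no x≢y = y , keep Oy x≢y , near
        dom′ w Sw | y , Oy , inj₁ refl | yes refl =
          let t , x~t , St = d-positive S (no-isolated x Sw) in t , keep (inside St x~t) (~⇒≢ x~t) , inj₂ x~t
        dom′ w Sw | y , Oy , inj₂ w~x | yes refl =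
          w , keep (inside Sw (~-sym w~x)) (~⇒≢ w~x ∘ sym) , inj₁ refl
        removal : ∀ k → size O ≤ k → ⊥
        smaller : 1 + size O′ ≤ size O
        smaller = begin
          1 + size O′                       ≡⟨ cong (_+ size O′) one ⟨
          size (O ∩ ⁅ x ⁆) + size O′        ≡⟨ size-split O ⁅ x ⁆ ⟨
          size O                            ∎
          where
          one : size (O ∩ ⁅ x ⁆) ≡ 1
          one = trans (∑-cong go) (size-⁅⁆ x)
            where
            go : ∀ y → ⟦ (O ∩ ⁅ x ⁆) y ⟧ ≡ ⟦ ⁅ x ⁆ y ⟧
            go y with x ≟ᶠ y
            ... | yes refl rewrite Ox = refl
            ... | no _ with O y
            ... | true = refl
            ... | false = refl
        removal zero h = 1+n≰n (≤-trans (≤-trans smaller h) z≤n)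
        removal (suc k) h = shrink k O′ (λ w p → O⊆S w (proj₁ (∖-elim O ⁅ x ⁆ p))) dom′ (s≤s⁻¹ (≤-trans smaller h))
      complement : Dominates (S ∖ O) S
      complement x Sx with O x in eq
      ... | false = x , ∖-intro S O Sx eq , inj₁ refl
      ... | true with d (S ∖ O) x in none
      ... | zero = ⊥-elim (redundant x eq none)
      ... | suc _ = let y , x~y , p = d-positive (S ∖ O) {x} (subst (1 ≤_) (sym none) (s≤s z≤n)) in y , p , inj₂ x~y

  -- Double counting over edges, the second potential Ψ and its invariants.

  swap : ∀ (p q : Fin n → ℕ) →
    ∑ (λ x → p x * ∑ (λ y → a x y * q y)) ≡ ∑ (λ y → q y * ∑ (λ x → a y x * p x))
  swap p q = begin
    ∑ (λ x → p x * ∑ (λ y → a x y * q y))    ≡⟨ ∑-cong (λ x → ∑-*ˡ (p x) (λ y → a x y * q y)) ⟨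
    ∑ (λ x → ∑ (λ y → p x * (a x y * q y)))  ≡⟨ ∑-comm (λ x y → p x * (a x y * q y)) ⟩
    ∑ (λ y → ∑ (λ x → p x * (a x y * q y)))  ≡⟨ ∑-cong (λ y → ∑-cong (λ x →
        trans (cong (λ t → p x * (⟦ t ⟧ * q y)) (symmetric G x y)) (t (p x) (a y x) (q y)))) ⟩
    ∑ (λ y → ∑ (λ x → q y * (a y x * p x)))  ≡⟨ ∑-cong (λ y → ∑-*ˡ (q y) (λ x → a y x * p x)) ⟩
    ∑ (λ y → q y * ∑ (λ x → a y x * p x))    ∎
    where
    open ≡-Reasoning
    t : ∀ u v w → u * (v * w) ≡ w * (v * u)
    t = solve-∀

  -- With 123 on leaves a white edge pays for one pick, 2 · (123 + 4 · 9) ≥ 315, and with 19 for each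
  -- white neighbour a vertex of a white cycle pays for half a pick, 2 · (105 + 3 · 19) ≥ 315.
  whiteΨ : ℕ → ℕ
  whiteΨ 0 = 105
  whiteΨ 1 = 123
  whiteΨ (suc (suc _)) = 105

  -- Agrees with `b` up to 2, the only range that `Inv` permits next to an isolated white vertex.
  bI : ℕ → ℕ
  bI 0 = 0
  bI 1 = 42
  bI (suc (suc _)) = 51

  -- The first argument counts isolated white neighbours, the second all white neighbours. The gap
  -- between the two rows is what a vertex releases on losing its isolated neighbour.
  β : ℕ → ℕ → ℕ
  β zero k = 19 * k
  β (suc _) k = bI k

  weightΨ : Bool → ℕ → ℕ → ℕ
  weightΨ true e k = whiteΨ k
  weightΨ false e k = β e k

  ψ : VSet n → Fin n → ℕ
  ψ W x = weightΨ (W x) (d (Iso W) x) (d W x)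

  Ψ : VSet n → ℕ
  Ψ W = ∑ (ψ W)

  whiteΨ≤123 : ∀ k → whiteΨ k ≤ 123
  whiteΨ≤123 0 = num
  whiteΨ≤123 1 = num
  whiteΨ≤123 (suc (suc _)) = num

  β-zero : ∀ e → β e 0 ≡ 0
  β-zero zero = refl
  β-zero (suc _) = refl

  β-step : ∀ e k l → 1 ≤ k → k + l ≤ 2 → β e k + 9 * l ≤ bI (k + l)
  β-step zero 1 0 _ _ = num
  β-step (suc _) 1 0 _ _ = num
  β-step zero 1 1 _ _ = num
  β-step (suc _) 1 1 _ _ = num
  β-step e 1 (suc (suc l)) _ (s≤s (s≤s ()))
  β-step zero 2 0 _ _ = num
  β-step (suc _) 2 0 _ _ = num
  β-step e 2 (suc l) _ (s≤s (s≤s ()))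
  β-step e (suc (suc (suc k))) l _ (s≤s (s≤s ()))

  -- The part of the first analysis that outlives the change of weight. That no pick gains enough in
  -- Φ says nothing about smaller white sets, but these four consequences can be inherited.
  record Inv (W : VSet n) : Set where
    field
      white≤2 : ∀ x → W x ≡ true → d W x ≤ 2
      nonwhite≤3 : ∀ z → W z ≡ false → d W z ≤ 3
      near-Iso≤2 : ∀ {z u} → W z ≡ false → Iso W u ≡ true → z ~ u → d W z ≤ 2
      Iso-unique : ∀ {z u u′} → W z ≡ false → Iso W u ≡ true → Iso W u′ ≡ true → z ~ u → z ~ u′ → u ≡ u′

  -- Degrees only fall, and a vertex that turns nonwhite was white before, so it had at most two
  -- white neighbours and no isolated one; it therefore meets the clauses for nonwhite vertices as
  -- well.
  Inv-∖ : ∀ {W} R → Inv W → (∀ u → Iso (W ∖ R) u ≡ true → Iso W u ≡ true) → Inv (W ∖ R)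
  Inv-∖ {W} R inv Iso⊆ = record
    { white≤2 = λ x p → ≤-trans (d-∖ W R x) (white≤2 x (proj₁ (∖-elim W R p)))
    ; nonwhite≤3 = λ z p → ≤-trans (d-∖ W R z) (three z (∖-elim-false W R p))
    ; near-Iso≤2 = λ {z} {u} p i z~u → ≤-trans (d-∖ W R z) (near-Iso≤2 (outside (Iso⊆ u i) z~u (∖-elim-false W R p)) (Iso⊆ u i) z~u)
    ; Iso-unique = λ {z} {u} {u′} p i i′ z~u z~u′ →
        Iso-unique (outside (Iso⊆ u i) z~u (∖-elim-false W R p)) (Iso⊆ u i) (Iso⊆ u′ i′) z~u z~u′
    }
    where
    open Inv inv
    three : ∀ z → W z ≡ false ⊎ (W z ≡ true × R z ≡ true) → d W z ≤ 3
    three z (inj₁ p) = nonwhite≤3 z p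
    three z (inj₂ (p , _)) = ≤-trans (white≤2 z p) num
    outside : ∀ {z u} → Iso W u ≡ true → z ~ u → W z ≡ false ⊎ (W z ≡ true × R z ≡ true) → W z ≡ false
    outside i z~u (inj₁ p) = p
    outside i z~u (inj₂ (p , _)) = ⊥-elim (Iso-white-≁ _ i p z~u)

  module Remove {W : VSet n} (inv : Inv W) (R : VSet n) (Iso⊆ : ∀ u → Iso (W ∖ R) u ≡ true → Iso W u ≡ true) where
    open Inv inv

    -- Without isolated white neighbours the weight is linear and pays 19 each. Otherwise one of at
    -- most two white neighbours is isolated and stays, so at most one is lost, and 51 - 42 = 9
    -- covers it.
    outside-step : ∀ z l → W z ≡ false → l ≤ d (W ∩ R) z →
      (∀ u → z ~ u → Iso W u ≡ true → R u ≡ false) →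
      β (d (Iso (W ∖ R)) z) (d (W ∖ R) z) + σ W z * l ≤ β (d (Iso W) z) (d W z)
    outside-step z l p l≤ stays with d (Iso W) z in e
    ... | zero = ≤-trans (+-monoʳ-≤ (β (d (Iso (W ∖ R)) z) (d (W ∖ R) z)) (*-monoʳ-≤ 19 l≤)) (≤-reflexive (begin-equality
      β (d (Iso (W ∖ R)) z) (d (W ∖ R) z) + 19 * d (W ∩ R) z
        ≡⟨ cong (λ k → β k (d (W ∖ R) z) + 19 * d (W ∩ R) z) (n≤0⇒n≡0 (subst (d (Iso (W ∖ R)) z ≤_) e (d-sub {Iso (W ∖ R)} {Iso W} z (λ u _ → Iso⊆ u)))) ⟩
      19 * d (W ∖ R) z + 19 * d (W ∩ R) z
        ≡⟨ *-distribˡ-+ 19 (d (W ∖ R) z) (d (W ∩ R) z) ⟨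
      19 * (d (W ∖ R) z + d (W ∩ R) z)
        ≡⟨ cong (19 *_) (d-split W R z) ⟨
      19 * d W z ∎))
      where open ≤-Reasoning
    ... | suc _ = ≤-trans (+-monoʳ-≤ (β (d (Iso (W ∖ R)) z) (d (W ∖ R) z)) (*-monoʳ-≤ 9 l≤))
        (subst (λ k → β (d (Iso (W ∖ R)) z) (d (W ∖ R) z) + 9 * d (W ∩ R) z ≤ bI k) (sym (d-split W R z))
          (β-step (d (Iso (W ∖ R)) z) (d (W ∖ R) z) (d (W ∩ R) z) kept (subst (_≤ 2) (d-split W R z) (near-Iso≤2 p i z~u))))
      where
      found = d-positive (Iso W) {z} (subst (1 ≤_) (sym e) (s≤s z≤n))
      u = proj₁ found
      z~u = proj₁ (proj₂ found)
      i = proj₂ (proj₂ found)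
      kept : 1 ≤ d (W ∖ R) z
      kept = d-one (W ∖ R) z~u (∖-intro W R (proj₁ (Iso-elim W i)) (stays u z~u i))

  σ≥9 : ∀ W z → 9 ≤ σ W z
  σ≥9 W z = go (d (Iso W) z)
    where
    go : ∀ k → 9 ≤ share k
    go zero = num
    go (suc _) = ≤-refl

  -- Excluded configurations and discharging for Ψ.

  module Stage₃ (W : VSet n) (inv : Inv W)
    -- Only picks that preserve `Inv` are ruled out, so every pick used below has to avoid creating
    -- isolated white vertices.
    (stuck : ∀ v → Inv (W ∖ N[ v ]) → Ψ (W ∖ N[ v ]) + 315 ≤ Ψ W → ⊥) where
    open Inv inv

    unchanged : ∀ R t → (∀ s → t ~ s → W s ≡ true → R s ≡ true → ⊥) → d (W ∖ R) t ≡ d W t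
    unchanged R t h = sym (trans (d-split W R t)
      (trans (cong (d (W ∖ R) t +_) (d-empty (W ∩ R) t (λ s p q → h s p (proj₁ (∩-elim W R q)) (proj₂ (∩-elim W R q))))) (+-identityʳ _)))

    -- The pick takes out a whole white component, so no surviving white vertex changes its degree.
    -- Each end yields 159 = 123 + 4 · 9.
    no-leaf-pair : ∀ {x y} → W x ≡ true → W y ≡ true → x ~ y → d W x ≡ 1 → d W y ≡ 1 → ⊥
    no-leaf-pair {x} {y} Wx Wy x~y dx dy = stuck x (Inv-∖ N[ x ] inv Iso⊆) (≤-trans (+-monoʳ-≤ (Ψ W′) gained) (≤-trans result (≤-reflexive (trans (cong (Ψ W +_) (∑-zero (λ _ → refl))) (+-identityʳ (Ψ W))))))
      where
      open ≤-Reasoning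
      R W′ : VSet n
      R = N[ x ]
      W′ = W ∖ R
      only-y : ∀ {s} → W s ≡ true → x ~ s → s ≡ y
      only-y {s} Ws x~s with s ≟ᶠ y
      ... | yes eq = eq
      ... | no s≢y = ⊥-elim (1+n≰n (subst (2 ≤_) dx (d-two W s≢y x~s Ws x~y Wy)))
      only-x : ∀ {s} → W s ≡ true → y ~ s → s ≡ x
      only-x {s} Ws y~s with s ≟ᶠ x
      ... | yes eq = eq
      ... | no s≢x = ⊥-elim (1+n≰n (subst (2 ≤_) dy (d-two W s≢x y~s Ws (~-sym x~y) Wx)))
      removed-are : ∀ {s} → W s ≡ true → R s ≡ true → s ≡ x ⊎ s ≡ y
      removed-are Ws Rs with N-elim Rs
      ... | inj₁ refl = inj₁ refl
      ... | inj₂ x~s = inj₂ (only-y Ws x~s)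
      same : ∀ t → W t ≡ true → R t ≡ false → d W′ t ≡ d W t
      same t Wt Rt = unchanged R t go
        where
        go : ∀ s → t ~ s → W s ≡ true → R s ≡ true → ⊥
        go s t~s Ws Rs with removed-are Ws Rs
        ... | inj₁ refl = true≢false (N-adj (~-sym t~s)) Rt
        ... | inj₂ refl with only-x Wt (~-sym t~s)
        ... | refl = true≢false (N-self x) Rt
      Iso⊆ : ∀ u → Iso W′ u ≡ true → Iso W u ≡ true
      Iso⊆ u i = let W′u , d′u = Iso-elim W′ i ; Wu , Ru = ∖-elim W R W′u in
        Iso-intro W Wu (trans (sym (same u Wu Ru)) d′u)
      kept : ∀ t → W t ≡ true → R t ≡ false → ψ W′ t ≤ ψ W t + 0
      kept t Wt Rt rewrite Wt | Rt | same t Wt Rt = ≤-reflexive (sym (+-identityʳ _))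
      removed : ∀ t → W t ≡ true → R t ≡ true → ψ W′ t + 159 ≤ ψ W t + D (∁ W) (λ _ → 9) t
      removed t Wt Rt rewrite ∖-false W R {t} Rt | Wt = subst (λ k → β (d (Iso W′) t) (d W′ t) + 159 ≤ whiteΨ k + D (∁ W) (λ _ → 9) t) (sym dt)
        (≤-trans (≤-reflexive (cong (_+ 159) (trans (cong (β (d (Iso W′) t)) d′t) (β-zero (d (Iso W′) t)))))
          (+-monoʳ-≤ 123 (subst (λ k → 9 * (5 ∸ k) ≤ D (∁ W) (λ _ → 9) t) dt (D-all W 9 t))))
        where
        dt : d W t ≡ 1
        dt with removed-are Wt Rt
        ... | inj₁ refl = dx
        ... | inj₂ refl = dy
        d′t : d W′ t ≡ 0
        d′t with removed-are Wt Rt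
        ... | inj₁ refl = d-picked W x
        ... | inj₂ refl = N-avoid W x y (λ s y~s Ws → subst (λ v → N[ x ] v ≡ true) (sym (only-x Ws y~s)) (N-self x))
      stays : ∀ z u → z ~ u → Iso W u ≡ true → R u ≡ false
      stays z u _ i with R u in Ru
      ... | false = refl
      ... | true with removed-are (proj₁ (Iso-elim W i)) Ru
      ... | inj₁ refl with trans (sym dx) (proj₂ (Iso-elim W i))
      ... | ()
      stays z u _ i | true | inj₂ refl with trans (sym dy) (proj₂ (Iso-elim W i))
      ... | ()
      outside : ∀ z → W z ≡ false → ψ W′ z + (D (W ∩ R) (λ _ → 9) z + 0) ≤ ψ W z
      outside z p rewrite p = ≤-trans
        (+-monoʳ-≤ (β (d (Iso W′) z) (d W′ z)) (≤-trans (≤-reflexive (trans (+-identityʳ _) (D-const (W ∩ R) 9 z)))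
          (*-monoˡ-≤ (d (W ∩ R) z) (σ≥9 W z))))
        (Remove.outside-step inv R Iso⊆ z (d (W ∩ R) z) p ≤-refl (stays z))
      result = account W R (ψ W) (ψ W′) (λ _ → 0) (λ _ → 159) (λ _ → 0) (λ _ _ → 9) kept removed outside
      at : ∀ {s} → W s ≡ true → R s ≡ true → ⟦ (W ∩ R) s ⟧ * 159 ≡ 159
      at p q rewrite p | q = refl
      gained : 315 ≤ ∑ (λ s → ⟦ (W ∩ R) s ⟧ * 159) + ∑ (λ z → ⟦ ∁ W z ⟧ * 0)
      gained = m≤n⇒m≤n+o (∑ (λ z → ⟦ ∁ W z ⟧ * 0)) (begin
        315 ≤⟨ num ⟩
        159 + 159 ≡⟨ cong₂ _+_ (at Wx (N-self x)) (at Wy (N-adj x~y)) ⟨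
        ⟦ (W ∩ R) x ⟧ * 159 + ⟦ (W ∩ R) y ⟧ * 159 ≤⟨ ∑-two (λ s → ⟦ (W ∩ R) s ⟧ * 159) (~⇒≢ x~y) ⟩
        ∑ (λ s → ⟦ (W ∩ R) s ⟧ * 159) ∎)

    -- The pick of v pays off through u: v releases 51, u yields 233 = 105 + 4 · 32, and x yields
    -- 131 or 85. The white neighbours of x have degree two, so they turn into leaves, at a loss of
    -- 123 - 105 = 18 each, and not into isolated vertices, which would endanger `Inv`.
    no-special : ∀ {v u x} → W v ≡ false → Iso W u ≡ true → v ~ u → W x ≡ true → (d W x ≡ 0 → ⊥) → v ~ x →
      (∀ t → W t ≡ true → x ~ t → d W t ≡ 2) → ⊥
    no-special {v} {u} {x} p i v~u Wx dx≢0 v~x all₂ = stuck v (Inv-∖ R inv Iso⊆)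
      (+-cancelʳ-≤ (18 * d W x) (Ψ W′ + 315) (Ψ W) (begin
        Ψ W′ + 315 + 18 * d W x                 ≡⟨ +-assoc (Ψ W′) 315 (18 * d W x) ⟩
        Ψ W′ + (315 + 18 * d W x)               ≤⟨ +-monoʳ-≤ (Ψ W′) gained ⟩
        Ψ W′ + (∑ (λ s → ⟦ (W ∩ R) s ⟧ * g s) + ∑ (λ z → ⟦ ∁ W z ⟧ * ξ z))
          ≤⟨ account W R (ψ W) (ψ W′) l g ξ ch kept removed outside ⟩
        Ψ W + ∑ l                               ≡⟨ cong (Ψ W +_) (∑-*ˡ 18 (λ t → a x t * ⟦ W t ⟧)) ⟩
        Ψ W + 18 * d W x                        ∎))
      where
      open ≤-Reasoning
      R W′ : VSet n
      R = N[ v ]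
      W′ = W ∖ R
      Wu = proj₁ (Iso-elim W i)
      du = proj₂ (Iso-elim W i)
      u≢x : u ≢ x
      u≢x refl = dx≢0 du
      removed-are : ∀ {s} → W s ≡ true → R s ≡ true → s ≡ u ⊎ s ≡ x
      removed-are {s} Ws Rs with N-elim Rs
      ... | inj₁ refl = ⊥-elim (true≢false Ws p)
      ... | inj₂ v~s with s ≟ᶠ u | s ≟ᶠ x
      ... | yes eq | _ = inj₁ eq
      ... | no _ | yes eq = inj₂ eq
      ... | no s≢u | no s≢x = ⊥-elim (1+n≰n (≤-trans (d-three W s≢u s≢x u≢x v~s Ws v~u Wu v~x Wx) (near-Iso≤2 p i v~u)))
      Wt-only-x : ∀ t → W t ≡ true → ∀ s → t ~ s → W s ≡ true → R s ≡ true → s ≡ x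
      Wt-only-x t Wt s t~s Ws Rs with removed-are Ws Rs
      ... | inj₁ refl = ⊥-elim (Iso-white-≁ W i Wt t~s)
      ... | inj₂ eq = eq
      same : ∀ t → W t ≡ true → adj G x t ≡ false → d W′ t ≡ d W t
      same t Wt x≁t = unchanged R t (λ s t~s Ws Rs →
        true≢false (~-sym (subst (t ~_) (Wt-only-x t Wt s t~s Ws Rs) t~s)) x≁t)
      lost≤1 : ∀ t → W t ≡ true → d (W ∩ R) t ≤ 1
      lost≤1 t Wt = ≤-trans (∑-mono go) (≤-reflexive (∑-δ (λ _ → 1) x))
        where
        go : ∀ s → a t s * ⟦ (W ∩ R) s ⟧ ≤ 1 * δ x s
        go s with adj G t s in t~s | (W ∩ R) s in q
        ... | false | _ = z≤n
        ... | true | false = z≤n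
        ... | true | true with Wt-only-x t Wt s t~s (proj₁ (∩-elim W R q)) (proj₂ (∩-elim W R q))
        ... | refl = ≤-reflexive (sym (trans (*-identityˡ _) (δ-refl x)))
      Iso⊆ : ∀ t → Iso W′ t ≡ true → Iso W t ≡ true
      Iso⊆ t j with Iso-elim W′ j
      ... | W′t , d′t with ∖-elim W R W′t | adj G x t in x~t
      ... | Wt , Rt | false = Iso-intro W Wt (trans (sym (same t Wt x~t)) d′t)
      ... | Wt , Rt | true = ⊥-elim (1+n≰n (begin
        2                           ≡⟨ all₂ t Wt x~t ⟨
        d W t                       ≡⟨ d-split W R t ⟩
        d W′ t + d (W ∩ R) t        ≡⟨ cong (_+ d (W ∩ R) t) d′t ⟩
        d (W ∩ R) t                 ≤⟨ lost≤1 t Wt ⟩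
        1                           ∎))
      -- 123 + 9 · 3 - 19 for a leaf, 105 + 9 · 2 - 2 · 19 for degree two; the subtracted term
      -- bounds the weight of x as a nonwhite vertex.
      own : ℕ → ℕ
      own 1 = 131
      own _ = 85
      ω g l ξ : Fin n → ℕ
      ω y = 32 * δ u y + 9 * δ x y
      g y = 233 * δ u y + own (d W x) * δ x y
      l t = 18 * (a x t * ⟦ W t ⟧)
      ξ z = 51 * δ v z
      ch : Fin n → Fin n → ℕ
      ch z y = erase v (λ _ → ω y) z
      kept : ∀ t → W t ≡ true → R t ≡ false → ψ W′ t ≤ ψ W t + l t
      kept t Wt Rt with adj G x t in x~t
      ... | false rewrite Wt | Rt | same t Wt x~t = ≤-reflexive (sym (+-identityʳ _))
      ... | true rewrite Wt | Rt | all₂ t Wt x~t = whiteΨ≤123 (d W′ t)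
      removed : ∀ t → W t ≡ true → R t ≡ true → ψ W′ t + g t ≤ ψ W t + D (∁ W) (λ z → ch z t) t
      removed t Wt Rt rewrite ∖-false W R {t} Rt | Wt with removed-are Wt Rt
      ... | inj₁ refl = begin
        β (d (Iso W′) u) (d W′ u) + g u        ≡⟨ cong₂ _+_ (trans (cong (β (d (Iso W′) u)) (n≤0⇒n≡0 (subst (d W′ u ≤_) du (d-∖ W R u)))) (β-zero (d (Iso W′) u))) gu ⟩
        105 + 32 * 4                           ≡⟨ cong (λ k → whiteΨ k + 32 * (4 ∸ k)) du ⟨
        whiteΨ (d W u) + 32 * (4 ∸ d W u)      ≡⟨ cong (λ m → whiteΨ (d W u) + m * (4 ∸ d W u)) ωu ⟨
        whiteΨ (d W u) + ω u * (4 ∸ d W u)     ≤⟨ +-monoʳ-≤ (whiteΨ (d W u)) (D-but-one W (ω u) v u) ⟩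
        whiteΨ (d W u) + D (∁ W) (λ z → ch z u) u ∎
        where
        ωu : ω u ≡ 32
        ωu rewrite δ-refl u | δ-≢ (u≢x ∘ sym) = refl
        gu : g u ≡ 233
        gu rewrite δ-refl u | δ-≢ (u≢x ∘ sym) | *-zeroʳ (own (d W x)) = refl
      ... | inj₂ refl = begin
        β (d (Iso W′) x) (d W′ x) + g x        ≡⟨ cong₂ (λ e k → β e (d W′ x) + k) none gx ⟩
        19 * d W′ x + own (d W x)              ≤⟨ +-monoˡ-≤ (own (d W x)) (*-monoʳ-≤ 19 (d-∖ W R x)) ⟩
        19 * d W x + own (d W x)               ≤⟨ gain (d W x) dx≢0 (white≤2 x Wx) ⟩
        whiteΨ (d W x) + 9 * (4 ∸ d W x)       ≡⟨ cong (λ m → whiteΨ (d W x) + m * (4 ∸ d W x)) ωx ⟨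
        whiteΨ (d W x) + ω x * (4 ∸ d W x)     ≤⟨ +-monoʳ-≤ (whiteΨ (d W x)) (D-but-one W (ω x) v x) ⟩
        whiteΨ (d W x) + D (∁ W) (λ z → ch z x) x ∎
        where
        none : d (Iso W′) x ≡ 0
        none = d-empty (Iso W′) x (λ s x~s j → Iso-white-≁ W (Iso⊆ s j) Wx x~s)
        ωx : ω x ≡ 9
        ωx rewrite δ-≢ u≢x | δ-refl x = refl
        gx : g x ≡ own (d W x)
        gx rewrite δ-≢ u≢x | δ-refl x = *-identityʳ _
        gain : ∀ k → (k ≡ 0 → ⊥) → k ≤ 2 → 19 * k + own k ≤ whiteΨ k + 9 * (4 ∸ k)
        gain 0 h _ = ⊥-elim (h refl)
        gain 1 _ _ = num
        gain 2 _ _ = num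
        gain (suc (suc (suc _))) _ (s≤s (s≤s ()))
      sub-ω : ∀ z → D (W ∩ R) ω z ≤ 32 * a z u + 9 * a z x
      sub-ω z = begin
        D (W ∩ R) ω z                                     ≤⟨ ∑-mono go ⟩
        ∑ (λ y → 32 * a z y * δ u y + 9 * a z y * δ x y)  ≡⟨ ∑-+ (λ y → 32 * a z y * δ u y) (λ y → 9 * a z y * δ x y) ⟩
        ∑ (λ y → 32 * a z y * δ u y) + ∑ (λ y → 9 * a z y * δ x y)
          ≡⟨ cong₂ _+_ (∑-δ (λ y → 32 * a z y) u) (∑-δ (λ y → 9 * a z y) x) ⟩
        32 * a z u + 9 * a z x                            ∎
        where
        go : ∀ y → a z y * (⟦ (W ∩ R) y ⟧ * ω y) ≤ 32 * a z y * δ u y + 9 * a z y * δ x y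
        go y with adj G z y | (W ∩ R) y
        ... | false | _ = z≤n
        ... | true | false = z≤n
        ... | true | true = ≤-reflexive (trans (+-identityʳ _) (+-identityʳ _))
      -- Such a z loses its only isolated neighbour u and falls from `bI` to 19 per remaining white
      -- neighbour. The tight case 51 - 19 = 32 fixes the rate paid to u.
      drop : ∀ k′ l k α → k ≡ k′ + l → k ≤ 2 → 1 + α ≤ l → 19 * k′ + (32 * 1 + 9 * α) ≤ bI k
      drop 0 1 k zero refl _ _ = num
      drop 0 2 k zero refl _ _ = num
      drop 0 2 k 1 refl _ _ = num
      drop 0 1 k (suc α) refl _ (s≤s ())
      drop 0 2 k (suc (suc α)) refl _ (s≤s (s≤s ()))
      drop 0 (suc (suc (suc l))) k α refl (s≤s (s≤s ())) _
      drop 1 1 k zero refl _ _ = num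
      drop 1 1 k (suc α) refl _ (s≤s ())
      drop 1 (suc (suc l)) k α refl (s≤s (s≤s ())) _
      drop (suc (suc k′)) (suc l) k α refl (s≤s (s≤s h)) _ with subst (_≤ 0) (+-suc k′ l) h
      ... | ()
      outside : ∀ z → W z ≡ false → ψ W′ z + (D (W ∩ R) (ch z) z + ξ z) ≤ ψ W z
      outside z q rewrite q with z ≟ᶠ v
      ... | yes refl = begin
        β (d (Iso W′) v) (d W′ v) + (D (W ∩ R) (ch v) v + ξ v)
          ≡⟨ cong₂ (λ s r → s + (r + ξ v)) (trans (cong (β (d (Iso W′) v)) (d-picked W v)) (β-zero (d (Iso W′) v)))
               (D-zero (W ∩ R) (ch v) v (λ y _ _ → erased (ω y))) ⟩
        ξ v                 ≡⟨ cong (51 *_) (δ-refl v) ⟩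
        51                  ≡⟨ has-Iso (d (Iso W) v) (d W v) (d-one (Iso W) v~u i) (d-two W u≢x v~u Wu v~x Wx) ⟨
        β (d (Iso W) v) (d W v) ∎
        where
        erased : ∀ c → c * ⟦ not (does (v ≟ᶠ v)) ⟧ ≡ 0
        erased c rewrite dec-true (v ≟ᶠ v) refl = *-zeroʳ c
        has-Iso : ∀ e k → 1 ≤ e → 2 ≤ k → β e k ≡ 51
        has-Iso (suc e) (suc (suc k)) _ _ = refl
        has-Iso (suc e) 1 _ (s≤s ())
      ... | no z≢v = begin
        β (d (Iso W′) z) (d W′ z) + (D (W ∩ R) (ch z) z + ξ z)
          ≤⟨ +-monoʳ-≤ (β (d (Iso W′) z) (d W′ z)) (+-mono-≤ (≤-trans (D-mono (W ∩ R) z (λ y _ _ → ≤-reflexive (erase-≢ (λ _ → ω y) v≢z))) (sub-ω z))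
               (≤-reflexive (cong (51 *_) (δ-≢ v≢z)))) ⟩
        β (d (Iso W′) z) (d W′ z) + (32 * a z u + 9 * a z x + 0)
          ≡⟨ cong (β (d (Iso W′) z) (d W′ z) +_) (+-identityʳ _) ⟩
        β (d (Iso W′) z) (d W′ z) + (32 * a z u + 9 * a z x)
          ≤⟨ rest ⟩
        β (d (Iso W) z) (d W z) ∎
        where
        v≢z = z≢v ∘ sym
        a≤ : a z x ≤ d (W ∩ R) z
        a≤ with adj G z x in z~x
        ... | false = z≤n
        ... | true = d-one (W ∩ R) z~x (true-∩ W R Wx (N-adj v~x))
        rest : β (d (Iso W′) z) (d W′ z) + (32 * a z u + 9 * a z x) ≤ β (d (Iso W) z) (d W z)
        rest with adj G z u in z~u
        ... | true = begin
          β (d (Iso W′) z) (d W′ z) + (32 * 1 + 9 * a z x)   ≡⟨ cong (λ e → β e (d W′ z) + (32 * 1 + 9 * a z x)) none ⟩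
          19 * d W′ z + (32 * 1 + 9 * a z x)                 ≤⟨ drop (d W′ z) (d (W ∩ R) z) (d W z) (a z x) (d-split W R z) (near-Iso≤2 q i z~u) lost ⟩
          bI (d W z)                                         ≡⟨ as-bI (d (Iso W) z) (d-one (Iso W) z~u i) ⟨
          β (d (Iso W) z) (d W z)                            ∎
          where
          as-bI : ∀ e → 1 ≤ e → β e (d W z) ≡ bI (d W z)
          as-bI (suc e) _ = refl
          none : d (Iso W′) z ≡ 0
          none = d-empty (Iso W′) z (λ s z~s j → true≢false (N-adj (subst (v ~_) (Iso-unique q i (Iso⊆ s j) z~u z~s) v~u))
            (proj₂ (∖-elim W R (proj₁ (Iso-elim W′ j)))))
          lost : 1 + a z x ≤ d (W ∩ R) z
          lost with adj G z x in z~x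
          ... | false = d-one (W ∩ R) z~u (true-∩ W R Wu (N-adj v~u))
          ... | true = d-two (W ∩ R) u≢x z~u (true-∩ W R Wu (N-adj v~u)) z~x (true-∩ W R Wx (N-adj v~x))
        ... | false = ≤-trans (+-monoʳ-≤ (β (d (Iso W′) z) (d W′ z)) (*-monoˡ-≤ (a z x) (σ≥9 W z)))
          (Remove.outside-step inv R Iso⊆ z (a z x) q a≤ stays)
          where
          stays : ∀ s → z ~ s → Iso W s ≡ true → R s ≡ false
          stays s z~s j with R s in Rs
          ... | false = refl
          ... | true with removed-are (proj₁ (Iso-elim W j)) Rs
          ... | inj₁ refl = ⊥-elim (true≢false z~s z~u)
          ... | inj₂ refl = ⊥-elim (dx≢0 (proj₂ (Iso-elim W j)))
      at-u : ⟦ (W ∩ R) u ⟧ * g u ≡ 233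
      at-u rewrite true-∩ W R Wu (N-adj v~u) | δ-refl u | δ-≢ (u≢x ∘ sym) | *-zeroʳ (own (d W x)) = refl
      at-x : ⟦ (W ∩ R) x ⟧ * g x ≡ own (d W x)
      at-x rewrite true-∩ W R Wx (N-adj v~x) | δ-≢ u≢x | δ-refl x = trans (+-identityʳ _) (*-identityʳ _)
      at-v : ⟦ ∁ W v ⟧ * ξ v ≡ 51
      at-v rewrite p | δ-refl v = refl
      enough : ∀ k → (k ≡ 0 → ⊥) → k ≤ 2 → 315 + 18 * k ≤ 233 + own k + 51
      enough 0 h _ = ⊥-elim (h refl)
      enough 1 _ _ = num
      enough 2 _ _ = num
      enough (suc (suc (suc _))) _ (s≤s (s≤s ()))
      gained : 315 + 18 * d W x ≤ ∑ (λ s → ⟦ (W ∩ R) s ⟧ * g s) + ∑ (λ z → ⟦ ∁ W z ⟧ * ξ z)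
      gained = begin
        315 + 18 * d W x         ≤⟨ enough (d W x) dx≢0 (white≤2 x Wx) ⟩
        233 + own (d W x) + 51   ≡⟨ cong₂ _+_ (cong₂ _+_ at-u at-x) at-v ⟨
        ⟦ (W ∩ R) u ⟧ * g u + ⟦ (W ∩ R) x ⟧ * g x + ⟦ ∁ W v ⟧ * ξ v
          ≤⟨ +-mono-≤ (∑-two (λ s → ⟦ (W ∩ R) s ⟧ * g s) u≢x) (∑-point (λ z → ⟦ ∁ W z ⟧ * ξ z) v) ⟩
        ∑ (λ s → ⟦ (W ∩ R) s ⟧ * g s) + ∑ (λ z → ⟦ ∁ W z ⟧ * ξ z) ∎

    special-leaf : ∀ {v u x} → W v ≡ false → Iso W u ≡ true → v ~ u → W x ≡ true → (d W x ≡ 0 → ⊥) → v ~ x →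
      d (Leaves W) x ≡ 0 → ⊥
    special-leaf {x = x} p i v~u Wx dx≢0 v~x none = no-special p i v~u Wx dx≢0 v~x
      (λ t Wt x~t → two t Wt x~t (d W t) refl)
      where
      two : ∀ t → W t ≡ true → x ~ t → ∀ k → d W t ≡ k → d W t ≡ 2
      two t Wt x~t 0 dt = ⊥-elim (d-zero W dt (~-sym x~t) Wx)
      two t Wt x~t 1 dt = ⊥-elim (d-zero (Leaves W) none x~t (Leaves-intro W Wt dt))
      two t Wt x~t 2 dt = dt
      two t Wt x~t (suc (suc (suc k))) dt with subst (_≤ 2) dt (white≤2 t Wt)
      ... | s≤s (s≤s ())

    S : Fin n → ℕ
    S x = D (∁ W) (σ W) x

    -- An isolated vertex finances a pick of its own: 315 = 105 + 5 · 42.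
    charged : ℕ → ℕ → ℕ
    charged 0 s = 315
    charged (suc k) s = whiteΨ (suc k) + s

    g : Fin n → ℕ
    g x = charged (d W x) (S x)

    -- All white vertices are removed at once, so the new weights vanish and Ψ is handed over to the
    -- white vertices. A nonwhite vertex owes 42 to its isolated neighbour and 9 to a second one,
    -- which is exactly `bI`, or 19 to each if none is isolated.
    discharge : ∑ (λ x → ⟦ (W ∩ W) x ⟧ * g x) ≤ Ψ W
    discharge = begin
      ∑ (λ x → ⟦ (W ∩ W) x ⟧ * g x)           ≤⟨ m≤m+n _ _ ⟩
      ∑ (λ x → ⟦ (W ∩ W) x ⟧ * g x) + ∑ (λ z → ⟦ ∁ W z ⟧ * 0)
        ≡⟨ cong (_+ (∑ (λ x → ⟦ (W ∩ W) x ⟧ * g x) + ∑ (λ z → ⟦ ∁ W z ⟧ * 0))) (∑-zero {n} (λ _ → refl)) ⟨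
      ∑ {n} (λ _ → 0) + (∑ (λ x → ⟦ (W ∩ W) x ⟧ * g x) + ∑ (λ z → ⟦ ∁ W z ⟧ * 0))
        ≤⟨ account W W (ψ W) (λ _ → 0) (λ _ → 0) g (λ _ → 0) ch (λ x p q → ⊥-elim (true≢false p q)) removed outside ⟩
      Ψ W + ∑ {n} (λ _ → 0)                   ≡⟨ cong (Ψ W +_) (∑-zero {n} (λ _ → refl)) ⟩
      Ψ W + 0                                 ≡⟨ +-identityʳ (Ψ W) ⟩
      Ψ W                                     ∎
      where
      open ≤-Reasoning
      pay : ℕ → ℕ → ℕ
      pay 0 s = 42
      pay (suc _) s = s
      ch : Fin n → Fin n → ℕ
      ch z y = pay (d W y) (σ W z)
      removed : ∀ x → W x ≡ true → W x ≡ true → g x ≤ ψ W x + D (∁ W) (λ z → ch z x) x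
      removed x p _ rewrite p with d W x in eq
      ... | suc k = ≤-refl
      ... | zero = +-monoʳ-≤ 105 (subst (λ k → 42 * (5 ∸ k) ≤ D (∁ W) (λ _ → 42) x) eq (D-all W 42 x))
      outside : ∀ z → W z ≡ false → D (W ∩ W) (ch z) z + 0 ≤ ψ W z
      outside z p rewrite p | +-identityʳ (D (W ∩ W) (ch z) z) with d (Iso W) z in e
      ... | zero = ≤-trans (D-≤ (W ∩ W) 19 z (λ y z~y q → far y z~y (proj₁ (∩-elim W W q)) (d W y) refl))
              (*-monoʳ-≤ 19 (d-sub {W ∩ W} {W} z (λ y _ q → proj₁ (∩-elim W W q))))
        where
        far : ∀ y → z ~ y → W y ≡ true → ∀ k → d W y ≡ k → pay k 19 ≤ 19
        far y z~y Wy zero dy = ⊥-elim (d-zero (Iso W) e z~y (Iso-intro W Wy dy))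
        far y z~y Wy (suc k) dy = ≤-refl
      ... | suc _ = begin
        D (W ∩ W) (λ y → pay (d W y) 9) z                       ≤⟨ D-mono (W ∩ W) z (λ y z~y q → near y z~y (proj₁ (∩-elim W W q)) (d W y) refl) ⟩
        D (W ∩ W) (λ y → 9 + 33 * δ u y) z                      ≡⟨ D-+ (W ∩ W) (λ _ → 9) (λ y → 33 * δ u y) z ⟩
        D (W ∩ W) (λ _ → 9) z + D (W ∩ W) (λ y → 33 * δ u y) z  ≤⟨ +-mono-≤ at-most once ⟩
        9 * d W z + 33                                          ≤⟨ fits (d W z) (d-one W z~u (proj₁ (Iso-elim W i))) (near-Iso≤2 p i z~u) ⟩
        bI (d W z)                                              ∎
        where
        found = d-positive (Iso W) {z} (subst (1 ≤_) (sym e) (s≤s z≤n))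
        u = proj₁ found
        z~u = proj₁ (proj₂ found)
        i = proj₂ (proj₂ found)
        near : ∀ y → z ~ y → W y ≡ true → ∀ k → d W y ≡ k → pay k 9 ≤ 9 + 33 * δ u y
        near y z~y Wy zero dy with Iso-unique p i (Iso-intro W Wy dy) z~u z~y
        ... | refl rewrite δ-refl u = ≤-refl
        near y z~y Wy (suc k) dy = m≤m+n 9 _
        at-most : D (W ∩ W) (λ _ → 9) z ≤ 9 * d W z
        at-most = ≤-trans (≤-reflexive (D-const (W ∩ W) 9 z))
          (*-monoʳ-≤ 9 (d-sub {W ∩ W} {W} z (λ y _ q → proj₁ (∩-elim W W q))))
        once : D (W ∩ W) (λ y → 33 * δ u y) z ≤ 33
        once = ≤-trans (∑-mono go) (≤-reflexive (∑-δ (λ _ → 33) u))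
          where
          go : ∀ y → a z y * (⟦ (W ∩ W) y ⟧ * (33 * δ u y)) ≤ 33 * δ u y
          go y with adj G z y | (W ∩ W) y
          ... | false | _ = z≤n
          ... | true | false = z≤n
          ... | true | true = ≤-reflexive (trans (+-identityʳ _) (+-identityʳ _))
        fits : ∀ k → 1 ≤ k → k ≤ 2 → 9 * k + 33 ≤ bI k
        fits 1 _ _ = num
        fits 2 _ _ = num
        fits (suc (suc (suc _))) _ (s≤s (s≤s ()))

    L M : VSet n
    L = Leaves W
    M = W ∖ Iso W

    -- A vertex short of charge has a leaf neighbour, which can spare 54.
    balance : ∀ x → 630 * ⟦ Iso W x ⟧ + 315 * ⟦ M x ⟧ + 54 * ⟦ L x ⟧ ≤ 2 * (⟦ (W ∩ W) x ⟧ * g x) + 54 * (⟦ W x ⟧ * d L x)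
    balance x = go (W x) (d W x) refl refl
      where
      open ≤-Reasoning
      go : ∀ w k → W x ≡ w → d W x ≡ k →
        630 * ⟦ Iso W x ⟧ + 315 * ⟦ M x ⟧ + 54 * ⟦ L x ⟧ ≤ 2 * (⟦ (W ∩ W) x ⟧ * g x) + 54 * (⟦ W x ⟧ * d L x)
      go false k p q rewrite p = z≤n
      go true 0 p q rewrite p | q = m≤m+n 630 _
      go true k@(suc k′) p q rewrite p | q = main (d L x) refl
        where
        dx≢0 : d W x ≡ 0 → ⊥
        dx≢0 e with trans (sym q) e
        ... | ()
        nine : 9 * (5 ∸ suc k′) ≤ S x
        nine = subst (λ j → 9 * (5 ∸ j) ≤ S x) q (≤-trans (D-all W 9 x) (D-mono (∁ W) x (λ z _ _ → σ≥9 W z)))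
        nineteen : d L x ≡ 0 → 19 * (5 ∸ suc k′) ≤ S x
        nineteen none = subst (λ j → 19 * (5 ∸ j) ≤ S x) q (≤-trans (D-all W 19 x) (D-mono (∁ W) x full))
          where
          -- A neighbour that pays only 9 sees an isolated vertex, and then `special-leaf` forces a
          -- leaf next to x.
          full : ∀ z → x ~ z → ∁ W z ≡ true → 19 ≤ σ W z
          full z x~z nz with d (Iso W) z in e
          ... | zero = ≤-refl
          ... | suc _ = let u , z~u , i = d-positive (Iso W) {z} (subst (1 ≤_) (sym e) (s≤s z≤n)) in
            ⊥-elim (special-leaf (nonwhite nz) i z~u p dx≢0 (~-sym x~z) none)
            where
            nonwhite : ∁ W z ≡ true → W z ≡ false
            nonwhite h with W z
            ... | false = refl
        no-leaf : ∀ s → 19 * (5 ∸ suc k′) ≤ s → k ≤ 2 → 315 + 54 * ⟦ isOne k ⟧ ≤ 2 * (whiteΨ k + s + 0) + 0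
        no-leaf s h k≤2 = begin
          315 + 54 * ⟦ isOne k ⟧                        ≤⟨ table k′ k≤2 ⟩
          2 * (whiteΨ k + 19 * (5 ∸ suc k′))            ≤⟨ *-monoʳ-≤ 2 (+-monoʳ-≤ (whiteΨ k) h) ⟩
          2 * (whiteΨ k + s)                            ≡⟨ t (whiteΨ k + s) ⟩
          2 * (whiteΨ k + s + 0) + 0                    ∎
          where
          t : ∀ r → 2 * r ≡ 2 * (r + 0) + 0
          t = solve-∀
          -- 2 · (123 + 4 · 19) = 398 against 315 + 54, and 2 · (105 + 3 · 19) = 324 against 315.
          table : ∀ j → suc j ≤ 2 → 315 + 54 * ⟦ isOne (suc j) ⟧ ≤ 2 * (whiteΨ (suc j) + 19 * (5 ∸ suc j))
          table 0 _ = num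
          table 1 _ = num
          table (suc (suc j)) (s≤s (s≤s ()))
        some-leaf : ∀ s l → 9 * (5 ∸ suc k′) ≤ s → k ≤ 2 → (k ≡ 1 → ⊥) →
          315 + 54 * ⟦ isOne k ⟧ ≤ 2 * (whiteΨ k + s + 0) + 54 * (suc l + 0)
        some-leaf s l h k≤2 k≢1 = begin
          315 + 54 * ⟦ isOne k ⟧                              ≤⟨ table k′ k≤2 k≢1 ⟩
          2 * (whiteΨ k + 9 * (5 ∸ suc k′)) + 54 * 1          ≤⟨ +-mono-≤ (*-monoʳ-≤ 2 (+-monoʳ-≤ (whiteΨ k) h)) (*-monoʳ-≤ 54 (s≤s z≤n)) ⟩
          2 * (whiteΨ k + s) + 54 * suc l                     ≡⟨ t (whiteΨ k + s) (suc l) ⟩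
          2 * (whiteΨ k + s + 0) + 54 * (suc l + 0)           ∎
          where
          t : ∀ r m → 2 * r + 54 * m ≡ 2 * (r + 0) + 54 * (m + 0)
          t = solve-∀
          -- 2 · (105 + 3 · 9) = 264 falls short of 315; the 54 from one leaf lift it to 318.
          table : ∀ j → suc j ≤ 2 → (suc j ≡ 1 → ⊥) → 315 + 54 * ⟦ isOne (suc j) ⟧ ≤ 2 * (whiteΨ (suc j) + 9 * (5 ∸ suc j)) + 54 * 1
          table 0 _ h = ⊥-elim (h refl)
          table 1 _ _ = num
          table (suc (suc j)) (s≤s (s≤s ())) _
        k≤2 : k ≤ 2
        k≤2 = subst (_≤ 2) q (white≤2 x p)
        main : ∀ l → d L x ≡ l → 315 + 54 * ⟦ isOne k ⟧ ≤ 2 * (whiteΨ k + S x + 0) + 54 * (d L x + 0)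
        main zero none = subst (λ l → 315 + 54 * ⟦ isOne k ⟧ ≤ 2 * (whiteΨ k + S x + 0) + 54 * (l + 0)) (sym none)
          (no-leaf (S x) (nineteen none) k≤2)
        main (suc l) some = subst (λ l → 315 + 54 * ⟦ isOne k ⟧ ≤ 2 * (whiteΨ k + S x + 0) + 54 * (l + 0)) (sym some)
          (some-leaf (S x) l nine k≤2 λ k≡1 →
            let y , x~y , Ly = d-positive L {x} (subst (1 ≤_) (sym some) (s≤s z≤n)) ; Wy , dy = Leaves-elim W Ly in
            no-leaf-pair p Wy x~y (trans q k≡1) dy)

    -- Everything is doubled because Ore's bound costs half a pick per vertex of `M`. A leaf has
    -- exactly one white neighbour, so the 54 given by leaves and the 54 received cancel in the sum.
    weigh : 630 * size (Iso W) + 315 * size M ≤ 2 * Ψ W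
    weigh = +-cancelʳ-≤ (54 * size L) _ _ (begin
      630 * size (Iso W) + 315 * size M + 54 * size L
        ≡⟨ cong₂ _+_ (cong₂ _+_ (∑-*ˡ 630 (λ x → ⟦ Iso W x ⟧)) (∑-*ˡ 315 (λ x → ⟦ M x ⟧))) (∑-*ˡ 54 (λ x → ⟦ L x ⟧)) ⟨
      ∑ (λ x → 630 * ⟦ Iso W x ⟧) + ∑ (λ x → 315 * ⟦ M x ⟧) + ∑ (λ x → 54 * ⟦ L x ⟧)
        ≡⟨ cong (_+ ∑ (λ x → 54 * ⟦ L x ⟧)) (∑-+ (λ x → 630 * ⟦ Iso W x ⟧) (λ x → 315 * ⟦ M x ⟧)) ⟨
      ∑ (λ x → 630 * ⟦ Iso W x ⟧ + 315 * ⟦ M x ⟧) + ∑ (λ x → 54 * ⟦ L x ⟧)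
        ≡⟨ ∑-+ (λ x → 630 * ⟦ Iso W x ⟧ + 315 * ⟦ M x ⟧) (λ x → 54 * ⟦ L x ⟧) ⟨
      ∑ (λ x → 630 * ⟦ Iso W x ⟧ + 315 * ⟦ M x ⟧ + 54 * ⟦ L x ⟧)
        ≤⟨ ∑-mono balance ⟩
      ∑ (λ x → 2 * (⟦ (W ∩ W) x ⟧ * g x) + 54 * (⟦ W x ⟧ * d L x))
        ≡⟨ ∑-+ (λ x → 2 * (⟦ (W ∩ W) x ⟧ * g x)) (λ x → 54 * (⟦ W x ⟧ * d L x)) ⟩
      ∑ (λ x → 2 * (⟦ (W ∩ W) x ⟧ * g x)) + ∑ (λ x → 54 * (⟦ W x ⟧ * d L x))
        ≡⟨ cong₂ _+_ (∑-*ˡ 2 (λ x → ⟦ (W ∩ W) x ⟧ * g x)) (∑-*ˡ 54 (λ x → ⟦ W x ⟧ * d L x)) ⟩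
      2 * ∑ (λ x → ⟦ (W ∩ W) x ⟧ * g x) + 54 * ∑ (λ x → ⟦ W x ⟧ * d L x)
        ≤⟨ +-mono-≤ (*-monoʳ-≤ 2 discharge) (≤-reflexive (cong (54 *_) (trans (swap (λ x → ⟦ W x ⟧) (λ x → ⟦ L x ⟧)) (∑-cong leaf-once)))) ⟩
      2 * Ψ W + 54 * size L ∎)
      where
      open ≤-Reasoning
      leaf-once : ∀ y → ⟦ L y ⟧ * d W y ≡ ⟦ L y ⟧
      leaf-once y with L y in eq
      ... | false = refl
      ... | true = trans (+-identityʳ _) (proj₂ (Leaves-elim W eq))

    final : (Coverable W (Ψ W) → ⊥) → ⊥
    final bad = half M M-nbr λ { (O , dom , small) → bad (O ∪ Iso W , Dominates-∪ O (Iso W) W (Iso W) dom (λ x _ i → x , i , inj₁ refl) , bound O small) }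
      where
      open ≤-Reasoning
      M-nbr : ∀ x → M x ≡ true → 1 ≤ d M x
      M-nbr x Mx with ∖-elim W (Iso W) Mx
      ... | Wx , ix with d-positive W {x} (n≢0⇒n>0 (λ dx → true≢false (Iso-intro W Wx dx) ix))
      ... | y , x~y , Wy = d-one M x~y (∖-intro W (Iso W) Wy nonIso)
        where
        nonIso : Iso W y ≡ false
        nonIso with Iso W y in j
        ... | false = refl
        ... | true = ⊥-elim (Iso-white-≁ W j Wx x~y)
      bound : ∀ O → 2 * size O ≤ size M → 315 * size (O ∪ Iso W) ≤ Ψ W
      bound O small = *-cancelˡ-≤ 2 (begin
        2 * (315 * size (O ∪ Iso W))                   ≤⟨ *-monoʳ-≤ 2 (*-monoʳ-≤ 315 (size-∪ O (Iso W))) ⟩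
        2 * (315 * (size O + size (Iso W)))            ≡⟨ t (size O) (size (Iso W)) ⟩
        630 * size (Iso W) + 315 * (2 * size O)        ≤⟨ +-monoʳ-≤ (630 * size (Iso W)) (*-monoʳ-≤ 315 small) ⟩
        630 * size (Iso W) + 315 * size M              ≤⟨ weigh ⟩
        2 * Ψ W                                        ∎)
        where
        t : ∀ p q → 2 * (315 * (p + q)) ≡ 630 * q + 315 * (2 * p)
        t = solve-∀

  -- Removing the white edges and passing from Φ to Ψ.

  module Switch (W : VSet n)
    (stuck : ∀ v → Φ (W ∖ N[ v ]) + 315 ≤ Φ W → ⊥)
    (stuck₂ : ∀ v w → Φ ((W ∖ N[ v ]) ∖ N[ w ]) + 630 ≤ Φ W → ⊥) where
    open Stage₁ W stuck stuck₂

    L W₂ : VSet n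
    L = Leaves W
    W₂ = W ∖ L

    -- By `leaf-neighbour` leaves come in adjacent pairs, so removing them deletes whole white
    -- components and leaves all other white degrees unchanged.
    leaf-closed : ∀ {x y} → L x ≡ true → W y ≡ true → x ~ y → L y ≡ true
    leaf-closed {x} {y} Lx Wy x~y = let Wx , dx = Leaves-elim W Lx in
      Leaves-intro W Wy (≤-antisym (leaf-neighbour y x Wy Wx (~-sym x~y) dx) (d-one W (~-sym x~y) Wx))

    same : ∀ x → W x ≡ true → L x ≡ false → d W₂ x ≡ d W x
    same x Wx nLx = sym (trans (d-split W L x) (trans (cong (d W₂ x +_) (d-empty (W ∩ L) x
      (λ y x~y q → true≢false (leaf-closed (proj₂ (∩-elim W L q)) Wx (~-sym x~y)) nLx))) (+-identityʳ _)))

    Iso⊆ : ∀ u → Iso W₂ u ≡ true → Iso W u ≡ true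
    Iso⊆ u i = let W₂u , d₂u = Iso-elim W₂ i ; Wu , nLu = ∖-elim W L W₂u in
      Iso-intro W Wu (trans (sym (same u Wu nLu)) d₂u)

    inv : Inv W
    inv = record { white≤2 = white≤2 ; nonwhite≤3 = nonwhite≤3 ; near-Iso≤2 = near-Iso≤2 ; Iso-unique = Iso-unique }

    inv₂ : Inv W₂
    inv₂ = Inv-∖ L inv Iso⊆

    -- No leaf survives in `W₂`, so every remaining white vertex weighs 105 in Ψ as in Φ, and what
    -- the nonwhite vertices lose together with the leaves pays the charges `S`.
    charge-leaves : Ψ W₂ + ∑ (λ x → ⟦ (W ∩ L) x ⟧ * (105 + S x)) ≤ Φ W
    charge-leaves = begin
      Ψ W₂ + ∑ (λ x → ⟦ (W ∩ L) x ⟧ * (105 + S x))   ≤⟨ +-monoʳ-≤ (Ψ W₂) (m≤m+n _ _) ⟩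
      Ψ W₂ + (∑ (λ x → ⟦ (W ∩ L) x ⟧ * (105 + S x)) + ∑ (λ z → ⟦ ∁ W z ⟧ * 0))
        ≤⟨ account W L (λ x → weight (W x) (d W x)) (ψ W₂) (λ _ → 0) (λ x → 105 + S x) (λ _ → 0) (λ z _ → σ W z) kept removed outside ⟩
      Φ W + ∑ {n} (λ _ → 0)                           ≡⟨ cong (Φ W +_) (∑-zero {n} (λ _ → refl)) ⟩
      Φ W + 0                                         ≡⟨ +-identityʳ (Φ W) ⟩
      Φ W                                             ∎
      where
      open ≤-Reasoning
      kept : ∀ x → W x ≡ true → L x ≡ false → ψ W₂ x ≤ weight (W x) (d W x) + 0
      kept x Wx nLx = begin
        ψ W₂ x                      ≡⟨ cong₂ (λ w k → weightΨ w (d (Iso W₂) x) k) (∖-intro W L Wx nLx) (same x Wx nLx) ⟩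
        whiteΨ (d W x)              ≤⟨ not-one (d W x) (λ dx → true≢false (Leaves-intro W Wx dx) nLx) ⟩
        105                         ≡⟨ cong (λ w → weight w (d W x) + 0) Wx ⟨
        weight (W x) (d W x) + 0    ∎
        where
        not-one : ∀ k → (k ≡ 1 → ⊥) → whiteΨ k ≤ 105
        not-one 0 _ = ≤-refl
        not-one 1 h = ⊥-elim (h refl)
        not-one (suc (suc _)) _ = ≤-refl
      removed : ∀ x → W x ≡ true → L x ≡ true →
        ψ W₂ x + (105 + S x) ≤ weight (W x) (d W x) + D (∁ W) (λ z → σ W z) x
      removed x Wx Lx = ≤-reflexive (cong₂ (λ s w → s + (weight w (d W x) + S x)) gone (sym Wx))
        where
        alone : d W₂ x ≡ 0
        alone = d-empty W₂ x (λ y x~y q → let Wy , nLy = ∖-elim W L q in true≢false (leaf-closed Lx Wy x~y) nLy)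
        gone : ψ W₂ x ≡ 0
        gone = trans (cong₂ (λ w k → weightΨ w (d (Iso W₂) x) k) (∖-false W L Lx) alone) (β-zero (d (Iso W₂) x))
      stays : ∀ z u → z ~ u → Iso W u ≡ true → L u ≡ false
      stays z u _ i with L u in Lu
      ... | false = refl
      ... | true with trans (sym (proj₂ (Leaves-elim W Lu))) (proj₂ (Iso-elim W i))
      ... | ()
      -- The change of weight itself: 19 per white neighbour fits because 3 · 19 = `b 3`, and `bI`
      -- coincides with `b` up to 2.
      β≤b : ∀ z → W z ≡ false → β (d (Iso W) z) (d W z) ≤ b (d W z)
      β≤b z p with d (Iso W) z in e
      ... | zero = few (d W z) (nonwhite≤3 z p)
        where
        few : ∀ k → k ≤ 3 → 19 * k ≤ b k
        few 0 _ = num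
        few 1 _ = num
        few 2 _ = num
        few 3 _ = num
        few (suc (suc (suc (suc _)))) (s≤s (s≤s (s≤s ())))
      ... | suc _ = let u , z~u , i = d-positive (Iso W) {z} (subst (1 ≤_) (sym e) (s≤s z≤n)) in
        few (d W z) (near-Iso≤2 p i z~u)
        where
        few : ∀ k → k ≤ 2 → bI k ≤ b k
        few 0 _ = num
        few 1 _ = num
        few 2 _ = num
        few (suc (suc (suc _))) (s≤s (s≤s ()))
      outside : ∀ z → W z ≡ false → ψ W₂ z + (D (W ∩ L) (λ _ → σ W z) z + 0) ≤ weight (W z) (d W z)
      outside z p = begin
        ψ W₂ z + (D (W ∩ L) (λ _ → σ W z) z + 0)
          ≡⟨ cong₂ (λ w k → weightΨ w (d (Iso W₂) z) (d W₂ z) + k) (∖-outside W L p) (trans (+-identityʳ _) (D-const (W ∩ L) (σ W z) z)) ⟩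
        β (d (Iso W₂) z) (d W₂ z) + σ W z * d (W ∩ L) z
          ≤⟨ Remove.outside-step inv L Iso⊆ z (d (W ∩ L) z) p ≤-refl (stays z) ⟩
        β (d (Iso W) z) (d W z)
          ≤⟨ β≤b z p ⟩
        b (d W z)
          ≡⟨ cong (λ w → weight w (d W z)) p ⟨
        weight (W z) (d W z) ∎

    -- `leaf-pair` is applied from both ends of every white edge: a leaf sees its own charge and
    -- that of its partner, so each charge is seen twice.
    leaf-charges : 105 * size L ≤ 2 * ∑ (λ x → ⟦ L x ⟧ * S x)
    leaf-charges = begin
      105 * size L
        ≡⟨ ∑-*ˡ 105 (λ x → ⟦ L x ⟧) ⟨
      ∑ (λ x → 105 * ⟦ L x ⟧)
        ≤⟨ ∑-mono pair ⟩
      ∑ (λ x → ⟦ L x ⟧ * S x + ⟦ L x ⟧ * D L S x)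
        ≡⟨ ∑-+ (λ x → ⟦ L x ⟧ * S x) (λ x → ⟦ L x ⟧ * D L S x) ⟩
      ∑ (λ x → ⟦ L x ⟧ * S x) + ∑ (λ x → ⟦ L x ⟧ * D L S x)
        ≡⟨ cong (∑ (λ x → ⟦ L x ⟧ * S x) +_) (swap (λ x → ⟦ L x ⟧) (λ y → ⟦ L y ⟧ * S y)) ⟩
      ∑ (λ x → ⟦ L x ⟧ * S x) + ∑ (λ y → ⟦ L y ⟧ * S y * d L y)
        ≤⟨ +-monoʳ-≤ (∑ (λ x → ⟦ L x ⟧ * S x)) (∑-mono once) ⟩
      ∑ (λ x → ⟦ L x ⟧ * S x) + ∑ (λ y → ⟦ L y ⟧ * S y)
        ≡⟨ t (∑ (λ x → ⟦ L x ⟧ * S x)) ⟩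
      2 * ∑ (λ x → ⟦ L x ⟧ * S x) ∎
      where
      open ≤-Reasoning
      t : ∀ p → p + p ≡ 2 * p
      t = solve-∀
      partner : ∀ x → L x ≡ true → 105 ≤ S x + D L S x
      partner x Lx = let Wx , dx = Leaves-elim W Lx
                         y , x~y , Wy = d-positive W {x} (≤-reflexive (sym dx))
                         Ly = leaf-closed Lx Wy x~y in
        ≤-trans (leaf-pair x y (Wx , dx) (Leaves-elim W Ly) x~y) (+-monoʳ-≤ (S x) (D-one L S x~y Ly))
      pair : ∀ x → 105 * ⟦ L x ⟧ ≤ ⟦ L x ⟧ * S x + ⟦ L x ⟧ * D L S x
      pair x with L x in Lx
      ... | false = z≤n
      ... | true = ≤-trans (partner x Lx) (≤-reflexive (sym (cong₂ _+_ (+-identityʳ (S x)) (+-identityʳ (D L S x)))))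
      once : ∀ y → ⟦ L y ⟧ * S y * d L y ≤ ⟦ L y ⟧ * S y
      once y with L y in Ly
      ... | false = z≤n
      ... | true = ≤-trans (*-monoʳ-≤ (S y + 0) (≤-trans (d-sub {L} {W} y (λ x _ q → proj₁ (Leaves-elim W q)))
              (≤-reflexive (proj₂ (Leaves-elim W Ly))))) (≤-reflexive (*-identityʳ _))

    -- Half of the leaves dominate them all, so a leaf has to bring 315 / 2: its weight 105, and 105
    -- / 2 as a lower bound for the average charge.
    switch : ((Coverable W₂ (Ψ W₂) → ⊥) → ⊥) → (Coverable W (Φ W) → ⊥) → ⊥
    switch cover₂ bad = cover₂ λ (A , domA , boundA) → half L nbr λ (O , domO , small) →
      bad (A ∪ O , Dominates-∪ A O W L domA (λ x _ → domO x) , bound A O boundA small)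
      where
      open ≤-Reasoning
      nbr : ∀ x → L x ≡ true → 1 ≤ d L x
      nbr x Lx = let Wx , dx = Leaves-elim W Lx
                     y , x~y , Wy = d-positive W {x} (≤-reflexive (sym dx)) in
        d-one L x~y (leaf-closed Lx Wy x~y)
      leaves : ∑ (λ x → ⟦ (W ∩ L) x ⟧ * (105 + S x)) ≡ 105 * size L + ∑ (λ x → ⟦ L x ⟧ * S x)
      leaves = trans (∑-cong go) (trans (∑-+ (λ x → 105 * ⟦ L x ⟧) (λ x → ⟦ L x ⟧ * S x)) (cong (_+ ∑ (λ x → ⟦ L x ⟧ * S x)) (∑-*ˡ 105 (λ x → ⟦ L x ⟧))))
        where
        go : ∀ x → ⟦ (W ∩ L) x ⟧ * (105 + S x) ≡ 105 * ⟦ L x ⟧ + ⟦ L x ⟧ * S x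
        go x with W x | isOne (d W x)
        ... | false | _ = refl
        ... | true | false = refl
        ... | true | true = refl
      bound : ∀ A O → 315 * size A ≤ Ψ W₂ → 2 * size O ≤ size L → 315 * size (A ∪ O) ≤ Φ W
      bound A O boundA small = *-cancelˡ-≤ 2 (begin
        2 * (315 * size (A ∪ O))                             ≤⟨ *-monoʳ-≤ 2 (*-monoʳ-≤ 315 (size-∪ A O)) ⟩
        2 * (315 * (size A + size O))                        ≡⟨ t (size A) (size O) ⟩
        2 * (315 * size A) + 315 * (2 * size O)              ≤⟨ +-mono-≤ (*-monoʳ-≤ 2 boundA) (*-monoʳ-≤ 315 small) ⟩
        2 * Ψ W₂ + 315 * size L                              ≡⟨ u (Ψ W₂) (size L) ⟩
        2 * (Ψ W₂ + 105 * size L) + 105 * size L             ≤⟨ +-monoʳ-≤ (2 * (Ψ W₂ + 105 * size L)) leaf-charges ⟩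
        2 * (Ψ W₂ + 105 * size L) + 2 * ∑ (λ x → ⟦ L x ⟧ * S x)
          ≡⟨ v (Ψ W₂) (105 * size L) (∑ (λ x → ⟦ L x ⟧ * S x)) ⟩
        2 * (Ψ W₂ + (105 * size L + ∑ (λ x → ⟦ L x ⟧ * S x)))
          ≡⟨ cong (λ k → 2 * (Ψ W₂ + k)) leaves ⟨
        2 * (Ψ W₂ + ∑ (λ x → ⟦ (W ∩ L) x ⟧ * (105 + S x)))  ≤⟨ *-monoʳ-≤ 2 charge-leaves ⟩
        2 * Φ W                                              ∎)
        where
        t : ∀ p q → 2 * (315 * (p + q)) ≡ 2 * (315 * p) + 315 * (2 * q)
        t = solve-∀
        u : ∀ p q → 2 * p + 315 * q ≡ 2 * (p + 105 * q) + 105 * q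
        u = solve-∀
        v : ∀ p q r → 2 * (p + q) + 2 * r ≡ 2 * (p + (q + r))
        v = solve-∀

  -- Induction on the potentials.

  cover₃ : ∀ k W → Inv W → Ψ W < k → (Coverable W (Ψ W) → ⊥) → ⊥
  cover₃ (suc k) W inv h bad = Stage₃.final W inv
    -- `descend` takes the gain in the form `suc c`, hence 314 for a gain of 315.
    (λ v inv′ gain → cover₃ k (W ∖ N[ v ]) inv′ (descend 314 gain h) (λ c → bad (Coverable-≤ W gain (pick W v c))))
    bad

  -- Since the goal is a contradiction, the failure of every pick may be assumed outright: a
  -- successful one is completed by the recursive call.
  cover₁ : ∀ k W → Φ W < k → (Coverable W (Φ W) → ⊥) → ⊥
  cover₁ (suc k) W h bad = switch (cover₃ (suc (Ψ W₂)) W₂ inv₂ ≤-refl) bad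
    where
    stuck : ∀ v → Φ (W ∖ N[ v ]) + 315 ≤ Φ W → ⊥
    stuck v gain = cover₁ k (W ∖ N[ v ]) (descend 314 gain h)
      (λ c → bad (Coverable-≤ W gain (pick W v c)))
    stuck₂ : ∀ v w → Φ ((W ∖ N[ v ]) ∖ N[ w ]) + 630 ≤ Φ W → ⊥
    stuck₂ v w gain = cover₁ k W″ (descend 629 gain h)
      (λ c → bad (Coverable-≤ W (≤-trans (≤-reflexive (+-assoc (Φ W″) 315 315)) gain) (pick W v (pick (W ∖ N[ v ]) w c))))
      where W″ = (W ∖ N[ v ]) ∖ N[ w ]
    open Switch W stuck stuck₂

  domination : (Coverable (λ _ → true) (105 * n) → ⊥) → ⊥
  domination bad = cover₁ (suc (Φ (λ _ → true))) (λ _ → true) ≤-refl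
    (λ c → bad (Coverable-≤ (λ _ → true) (≤-reflexive (∑-const n 105)) c))

-- Transfer to the given notions of degree and dominating set.

does-true : ∀ {b} (p : Dec (b ≡ true)) → does p ≡ b
does-true (yes refl) = refl
does-true {true} (no ¬p) = ⊥-elim (¬p refl)
does-true {false} (no _) = refl

opaque
  unfolding ∑

  -- Serves degrees and cardinalities alike, both being counts over a tabulated vector.
  count-tabulate : ∀ {n} {A : Set} (q : A → Bool) (P? : ∀ x → Dec (q x ≡ true)) (f : Fin n → A) →
    count P? (tabulate f) ≡ ∑ (λ i → ⟦ q (f i) ⟧)
  count-tabulate {zero} q P? f = refl
  count-tabulate {suc n} q P? f rewrite does-true (P? (f zero)) with q (f zero)
  ... | true = cong suc (count-tabulate q P? (f ∘ suc))
  ... | false = count-tabulate q P? (f ∘ suc)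

theorem1 : ∀ (n : ℕ) (G : Graph n) (γ : ℕ) → MinDegree G 5 → IsDominationNumber G γ → 3 * γ ≤ n
theorem1 n G γ (mindeg , _) (_ , minimal) = decidable-stable (3 * γ ≤? n) λ large →
  domination λ (A , dom , bound) → large (*-cancelˡ-≤ 105 (begin
    105 * (3 * γ)               ≡⟨ *-assoc 105 3 γ ⟨
    315 * γ                     ≤⟨ *-monoʳ-≤ 315 (minimal (tabulate A) (dominating A dom)) ⟩
    315 * ∣ tabulate A ∣        ≡⟨ cong (315 *_) (count-tabulate (λ c → c) _ A) ⟩
    315 * size A                ≤⟨ bound ⟩
    105 * n                     ∎))
  where
  open ≤-Reasoning
  deg≥5 : ∀ x → 5 ≤ ∑ (λ y → ⟦ adj G x y ⟧)
  deg≥5 x = ≤-trans (mindeg x) (≤-reflexive (count-tabulate (adj G x) _ (λ y → y)))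
  open Domination G deg≥5 using (Dominates; domination)
  dominating : ∀ A → Dominates A (λ _ → true) → IsDominating G (tabulate A)
  dominating A dom v with dom v refl
  ... | y , Ay , near with lookup⇒[]= y (tabulate A) (trans (lookup∘tabulate A y) Ay) | near
  ... | y∈A | inj₁ refl = inj₁ y∈A
  ... | y∈A | inj₂ v~y = inj₂ (y , y∈A , v~y)
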